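{- Let $\mathcal{G}_{n,2}$ denote a uniformly random $2$-regular graph on $n$ vertices. Then asymptotically almost surely $H(\mathcal{G}_{n,2}) \sim \frac{3}{2}\log n$, i.e. $H(\mathcal{G}_{n,2}) = (1+o(1))\frac{3}{2}\log n$ with probability tending to $1$ as $n\to\infty$.
   Context: Hopping forcing: given a graph $G$ with each vertex coloured blue or white, the hopping forcing rule allows a blue vertex $b$ to force (recolour blue) a white vertex $w$ at distance exactly two from $b$, provided that every neighbour of $b$ is blue and $b$ has not previously performed a force (each vertex can perform at most one force during the whole process). A set $B\subseteq V(G)$ is feasible if, starting with exactly the vertices of $B$ blue, repeated (sequential, one force at a time) applications of the rule can make all vertices blue. The hopping forcing number $H(G)$ is the minimum size of a feasible set. $\mathcal{G}_{n,d}$ is the uniform probability space of $d$-regular simple graphs on $n$ labelled vertices ($dn$ even), $d$ fixed and $n\to\infty$. An event holds asymptotically almost surely (a.a.s.) if its probability tends to $1$ as $n\to\infty$; $\log$ is the natural logarithm. -}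

module Defs where

open import Data.Nat using (ℕ; zero; suc; _+_; _*_; _^_; _≤_; _<_; _≡ᵇ_; _!)
open import Data.Nat.ListAction using (sum)
open import Data.Bool.ListAction using (and)
open import Data.Sum using (_⊎_)
open import Data.Bool using (Bool; true; false; if_then_else_; _∧_; T)
open import Data.Fin using (Fin)
open import Data.Fin.Subset using (Subset; _∈_; _∉_; _∪_; ⁅_⁆; ⊥; ∣_∣)
open import Data.Vec using (Vec; lookup; []; _∷_)
open import Data.List using (List; []; _∷_; map; concatMap; length; allFin; filterᵇ)
open import Data.Product using (_×_; _,_; ∃-syntax)
open import Relation.Binary.PropositionalEquality using (_≡_; _≢_)
open import Relation.Binary.Construct.Closure.ReflexiveTransitive using (Star)
open import Relation.Nullary using (¬_)

Graph : ℕ → Set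
Graph n = Vec (Vec Bool n) n

adjᵇ : ∀ {n} → Graph n → Fin n → Fin n → Bool
adjᵇ G u v = lookup (lookup G u) v

Adj : ∀ {n} → Graph n → Fin n → Fin n → Set
Adj G u v = adjᵇ G u v ≡ true

_==ᵇ_ : Bool → Bool → Bool
true ==ᵇ b = b
false ==ᵇ true = false
false ==ᵇ false = true

not' : Bool → Bool
not' true = false
not' false = true

degree : ∀ {n} → Graph n → Fin n → ℕ
degree {n} G u = sum (map (λ v → if adjᵇ G u v then 1 else 0) (allFin n))

is2Regularᵇ : ∀ {n} → Graph n → Bool
is2Regularᵇ {n} G =
  and (map (λ u →
    not' (adjᵇ G u u) ∧ (degree G u ≡ᵇ 2) ∧
    and (map (λ v → adjᵇ G u v ==ᵇ adjᵇ G v u) (allFin n))) (allFin n))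

Is2Regular : ∀ {n} → Graph n → Set
Is2Regular G = T (is2Regularᵇ G)

allVecs : ∀ {a} {A : Set a} (k : ℕ) → List A → List (Vec A k)
allVecs zero xs = [] ∷ []
allVecs (suc k) xs = concatMap (λ x → map (x ∷_) (allVecs k xs)) xs

allGraphs : (n : ℕ) → List (Graph n)
allGraphs n = allVecs n (allVecs n (true ∷ false ∷ []))

num2Regular : ℕ → ℕ
num2Regular n = length (filterᵇ is2Regularᵇ (allGraphs n))

Dist2 : ∀ {n} → Graph n → Fin n → Fin n → Set
Dist2 G b w = (b ≢ w) × ¬ Adj G b w × ∃[ c ] (Adj G b c × Adj G c w)

-- state = (blue vertices , vertices that have already forced)
State : ℕ → Set
State n = Subset n × Subset n

data HopStep {n} (G : Graph n) : State n → State n → Set where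
  force : ∀ {Bl U} (b w : Fin n) →
          b ∈ Bl → b ∉ U → w ∉ Bl → Dist2 G b w →
          (∀ v → Adj G b v → v ∈ Bl) →
          HopStep G (Bl , U) (Bl ∪ ⁅ w ⁆ , U ∪ ⁅ b ⁆)

Feasible : ∀ {n} → Graph n → Subset n → Set
Feasible {n} G B = ∃[ Bl ] ∃[ U ] (Star (HopStep G) (B , ⊥) (Bl , U) × (∀ v → v ∈ Bl))

-- Comparisons with the exponential function (used to compare with log n).
-- expPartial m j = j! * Σ_{i=0}^{j} m^i / i!   (a natural number)

expPartial : ℕ → ℕ → ℕ
expPartial m zero = 1
expPartial m (suc j) = suc j * expPartial m j + m ^ suc j

ExpLe : ℕ → ℕ → Set
ExpLe m N = ∀ j → expPartial m j ≤ N * (j !)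

ExpGt : ℕ → ℕ → Set
ExpGt m N = ∃[ j ] (N * (j !) < expPartial m j)

-- With ε = 1/(t+1):
-- H(G) ≤ (1-ε)(3/2) log n  :  some feasible B with 2(t+1)|B| ≤ 3t log n,
--                              i.e. e^{2(t+1)|B|} ≤ n^{3t}
HLow : ∀ {n} → ℕ → Graph n → Set
HLow {n} t G = ∃[ B ] (Feasible G B × ExpLe (2 * suc t * ∣ B ∣) (n ^ (3 * t)))

-- H(G) > (1+ε)(3/2) log n  :  every feasible B has 2(t+1)|B| > 3(t+2) log n,
--                              i.e. e^{2(t+1)|B|} > n^{3(t+2)}
HHigh : ∀ {n} → ℕ → Graph n → Set
HHigh {n} t G = ∀ B → Feasible G B → ExpGt (2 * suc t * ∣ B ∣) (n ^ (3 * (t + 2)))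

Bad : (t n : ℕ) → Graph n → Set
Bad t n G = Is2Regular G × (HLow t G ⊎ HHigh t G)

module Submission where

-- A force stays inside its cycle; the first force in a cycle needs a blue vertex with two blue
-- neighbours, and conversely three consecutive blue vertices force their way around the cycle.
-- Hence H(G) is three times the number c(G) of cycles of G.
--
-- Deleting the first vertex of a 2-regular graph and joining its two neighbours, or deleting its
-- whole triangle when these are already adjacent, gives W(n+1) = n W(n) + x C(n,2) W(n-2) for
-- W(n) = Σ x^c(G) over the 2-regular graphs on n vertices. By this recurrence the ratio of the
-- values of W(n) at x and at 1 has order n^((x-1)/2). Markov's inequality for x^c(G), with x
-- slightly above or slightly below 1, then confines c(G) to (1 ± ε) (log n)/2.

-- Since W(n-2) is about W(n)/n^2, the recurrence gives W(n+1)/W(n) close to n + x/2, against n +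
-- 1/2 for x = 1. So one more vertex multiplies the ratio of the two values by about 1 + (x-1)/(2n),
-- which is where the exponent (x-1)/2 comes from. The choice x = 1 + 1/b or x = 1 - 1/b makes x or
-- 1/x the base of the bracket (1+1/p)^p < e < (1+1/p)^(p+1). A comparison of e^(6(t+1)c) with a
-- power of n, as it comes from a bad graph, thus turns directly into one for x^c. Everything is
-- stated in natural numbers: x = a/b, a graph with c cycles weighs a^c b^(n-c), and estimates with
-- roots are raised to a common power. The deletion is run backwards: a code records how vertices
-- are put back. Once the cycles are oriented, n vertices have n arcs, so an insertion is indexed by
-- the vertex that its arc leaves. Codes correspond one to one to the 2-regular graphs, and the
-- number of cycles is read off the code, so that no notion of connected component is needed.

-- Integer forms of (1+1/p)^p ≤ e ≤ (1+1/d)^(d+1).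

module ExponentialSeries where
  open import Defs
  open import Data.Nat
  open import Data.Nat.Properties
  open import Data.Nat.Tactic.RingSolver using (solve-∀)
  open import Data.Product using (_,_)
  open import Relation.Binary.PropositionalEquality

  ^-distribʳ-* : ∀ k m n → (m * n) ^ k ≡ m ^ k * n ^ k
  ^-distribʳ-* zero    m n = refl
  ^-distribʳ-* (suc k) m n = trans (cong (m * n *_) (^-distribʳ-* k m n)) (lem m n (m ^ k) (n ^ k))
    where
    lem : ∀ m n a b → m * n * (a * b) ≡ m * a * (n * b)
    lem = solve-∀

  -- j! p^j Σ_{i≤j} (q/p)^i / i!
  scaledExp : ℕ → ℕ → ℕ → ℕ
  scaledExp p q zero    = 1
  scaledExp p q (suc j) = suc j * p * scaledExp p q j + q ^ suc j

  -- With the next lemma, the mean value bounds for x^(k+1) between q and q + 1: the slope lies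
  -- between its values at the two ends.
  bernoulli-lower : ∀ q k → q ^ suc k + suc k * q ^ k ≤ suc q ^ suc k
  bernoulli-lower q zero    = ≤-reflexive (lem q)
    where
    lem : ∀ q → q * 1 + 1 ≡ suc q * 1
    lem = solve-∀
  bernoulli-lower q (suc k) = begin
    q * Q + suc (suc k) * Q                  ≤⟨ m≤m+n _ (suc k * q ^ k) ⟩
    q * Q + suc (suc k) * Q + suc k * q ^ k  ≡⟨ lem q (q ^ k) k ⟩
    suc q * (Q + suc k * q ^ k)              ≤⟨ *-monoʳ-≤ (suc q) (bernoulli-lower q k) ⟩
    suc q * suc q ^ suc k                    ∎
    where
    open ≤-Reasoning
    Q = q ^ suc k
    lem : ∀ q r k → q * (q * r) + suc (suc k) * (q * r) + suc k * r ≡ suc q * (q * r + suc k * r)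
    lem = solve-∀

  bernoulli-upper : ∀ q k → suc q ^ suc k ≤ q ^ suc k + suc k * suc q ^ k
  bernoulli-upper q zero    = ≤-reflexive (lem q)
    where
    lem : ∀ q → suc q * 1 ≡ q * 1 + 1
    lem = solve-∀
  bernoulli-upper q (suc k) = begin
    suc q * Q                                ≡⟨⟩
    Q + q * Q                                ≤⟨ +-monoʳ-≤ Q (*-monoʳ-≤ q (bernoulli-upper q k)) ⟩
    Q + q * (q ^ suc k + suc k * suc q ^ k)  ≤⟨ m≤m+n _ (suc k * suc q ^ k) ⟩
    Q + q * (q ^ suc k + suc k * suc q ^ k) + suc k * suc q ^ k
                                             ≡⟨ lem q (q ^ suc k) (suc q ^ k) k ⟩
    q * q ^ suc k + suc (suc k) * Q          ∎
    where
    open ≤-Reasoning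
    Q = suc q ^ suc k
    lem : ∀ q r s k → suc q * s + q * (r + suc k * s) + suc k * s ≡ q * r + suc (suc k) * (suc q * s)
    lem = solve-∀

  -- As a polynomial in `q`, `scaledExp p q (suc j)` has derivative `suc j * scaledExp p q j`. Here
  -- and in the next lemma the mean value bounds for powers are added up term by term.
  scaledExp-increment-lower : ∀ p q j →
    scaledExp p q (suc j) + suc j * scaledExp p q j ≤ scaledExp p (suc q) (suc j)
  scaledExp-increment-lower p q zero    = ≤-reflexive (lem p q)
    where
    lem : ∀ p q → 1 * p * 1 + q * 1 + 1 * 1 ≡ 1 * p * 1 + suc q * 1
    lem = solve-∀
  scaledExp-increment-lower p q (suc j) = begin
    c * E₁ + q ^ suc (suc j) + suc (suc j) * (suc j * p * E₀ + Q)
      ≡⟨ lem p E₁ E₀ (q ^ suc (suc j)) Q j ⟩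
    c * (E₁ + suc j * E₀) + (q ^ suc (suc j) + suc (suc j) * Q)
      ≤⟨ +-mono-≤ (*-monoʳ-≤ c (scaledExp-increment-lower p q j)) (bernoulli-lower q (suc j)) ⟩
    c * scaledExp p (suc q) (suc j) + suc q ^ suc (suc j) ∎
    where
    open ≤-Reasoning
    c = suc (suc j) * p
    E₀ = scaledExp p q j
    E₁ = scaledExp p q (suc j)
    Q = q ^ suc j
    lem : ∀ p e₁ e₀ r s j → suc (suc j) * p * e₁ + r + suc (suc j) * (suc j * p * e₀ + s)
        ≡ suc (suc j) * p * (e₁ + suc j * e₀) + (r + suc (suc j) * s)
    lem = solve-∀

  scaledExp-increment-upper : ∀ p q j →
    scaledExp p (suc q) (suc j) ≤ scaledExp p q (suc j) + suc j * scaledExp p (suc q) j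
  scaledExp-increment-upper p q zero    = ≤-reflexive (lem p q)
    where
    lem : ∀ p q → 1 * p * 1 + suc q * 1 ≡ 1 * p * 1 + q * 1 + 1 * 1
    lem = solve-∀
  scaledExp-increment-upper p q (suc j) = begin
    c * scaledExp p (suc q) (suc j) + suc q ^ suc (suc j)
      ≤⟨ +-mono-≤ (*-monoʳ-≤ c (scaledExp-increment-upper p q j)) (bernoulli-upper q (suc j)) ⟩
    c * (E₁ + suc j * E₀) + (q ^ suc (suc j) + suc (suc j) * Q)
      ≡⟨ lem p E₁ E₀ (q ^ suc (suc j)) Q j ⟩
    c * E₁ + q ^ suc (suc j) + suc (suc j) * (suc j * p * E₀ + Q) ∎
    where
    open ≤-Reasoning
    c = suc (suc j) * p
    E₀ = scaledExp p (suc q) j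
    E₁ = scaledExp p q (suc j)
    Q = suc q ^ suc j
    lem : ∀ p e₁ e₀ r s j → suc (suc j) * p * (e₁ + suc j * e₀) + (r + suc (suc j) * s)
        ≡ suc (suc j) * p * e₁ + r + suc (suc j) * (suc j * p * e₀ + s)
    lem = solve-∀

  scaledExp-suc-≥ : ∀ p q j → suc j * p * scaledExp p q j ≤ scaledExp p q (suc j)
  scaledExp-suc-≥ p q j = m≤m+n _ _

  scaledExp-integral : ∀ p m j → scaledExp p (p * m) j ≡ p ^ j * expPartial m j
  scaledExp-integral p m zero    = refl
  scaledExp-integral p m (suc j) = begin
    suc j * p * scaledExp p (p * m) j + (p * m) ^ suc j
      ≡⟨ cong₂ (λ a b → suc j * p * a + b) (scaledExp-integral p m j) (^-distribʳ-* (suc j) p m) ⟩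
    suc j * p * (p ^ j * expPartial m j) + p ^ suc j * m ^ suc j
      ≡⟨ lem p (p ^ j) (expPartial m j) (m ^ suc j) j ⟩
    p ^ suc j * (suc j * expPartial m j + m ^ suc j) ∎
    where
    open ≡-Reasoning
    lem : ∀ p r e s j → suc j * p * (r * e) + p * r * s ≡ p * r * (suc j * e + s)
    lem = solve-∀

  scaledExp-zero : ∀ p j → scaledExp p 0 j ≡ p ^ j * j !
  scaledExp-zero p zero    = refl
  scaledExp-zero p (suc j) rewrite scaledExp-zero p j = lem p (p ^ j) (j !) j
    where
    lem : ∀ p r f j → suc j * p * (r * f) + 0 ≡ p * r * (suc j * f)
    lem = solve-∀

  -- After division by q! p^q this bounds (1+1/p)^q by the series of e^(q/p) cut off at order q.
  -- Order and argument grow together: raising the order contributes the factor `suc q * p`, raising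
  -- the argument another `suc q`, together `suc q * suc p`.
  power≤scaledExp : ∀ p q → suc p ^ q * q ! ≤ scaledExp p q q
  power≤scaledExp p zero    = ≤-refl
  power≤scaledExp p (suc q) = begin
    suc p * suc p ^ q * (suc q * q !)          ≡⟨ lem (suc p) (suc p ^ q) (suc q) (q !) ⟩
    suc q * suc p * (suc p ^ q * q !)          ≤⟨ *-monoʳ-≤ (suc q * suc p) (power≤scaledExp p q) ⟩
    suc q * suc p * scaledExp p q q            ≡⟨ lem' q p (scaledExp p q q) ⟩
    suc q * p * scaledExp p q q + suc q * scaledExp p q q
                                               ≤⟨ +-monoˡ-≤ _ (scaledExp-suc-≥ p q q) ⟩
    scaledExp p q (suc q) + suc q * scaledExp p q q ≤⟨ scaledExp-increment-lower p q q ⟩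
    scaledExp p (suc q) (suc q)                ∎
    where
    open ≤-Reasoning
    lem : ∀ a b c d → a * b * (c * d) ≡ c * a * (b * d)
    lem = solve-∀
    lem' : ∀ q p e → suc q * suc p * e ≡ suc q * p * e + suc q * e
    lem' = solve-∀

  -- A form of e^(1/(d+1)) ≤ (d+1)/d valid at every truncation order. The increment bound gives the
  -- new value d + 1 times on the left and once on the right, and one copy cancels.
  scaledExp-ratio : ∀ d r j → d * scaledExp (suc d) (suc r) j ≤ suc d * scaledExp (suc d) r j
  scaledExp-ratio d r zero    = *-monoˡ-≤ 1 (n≤1+n d)
  scaledExp-ratio d r (suc j) = +-cancelˡ-≤ E′ _ _ (begin
    suc d * E′                      ≤⟨ *-monoʳ-≤ (suc d) (scaledExp-increment-upper (suc d) r j) ⟩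
    suc d * (E + suc j * E₀)        ≡⟨ lem d E E₀ j ⟩
    suc j * suc d * E₀ + suc d * E  ≤⟨ +-monoˡ-≤ (suc d * E) (scaledExp-suc-≥ (suc d) (suc r) j) ⟩
    E′ + suc d * E                  ∎)
    where
    open ≤-Reasoning
    E′ = scaledExp (suc d) (suc r) (suc j)
    E  = scaledExp (suc d) r (suc j)
    E₀ = scaledExp (suc d) (suc r) j
    lem : ∀ d e e₀ j → suc d * (e + suc j * e₀) ≡ suc j * suc d * e₀ + suc d * e
    lem = solve-∀

  scaledExp≤power : ∀ d r j → d ^ r * scaledExp (suc d) r j ≤ suc d ^ r * (suc d ^ j * j !)
  scaledExp≤power d zero    j = ≤-reflexive (cong (_+ 0) (scaledExp-zero (suc d) j))
  scaledExp≤power d (suc r) j = begin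
    d * d ^ r * scaledExp (suc d) (suc r) j    ≡⟨ lem d (d ^ r) _ ⟩
    d ^ r * (d * scaledExp (suc d) (suc r) j)  ≤⟨ *-monoʳ-≤ (d ^ r) (scaledExp-ratio d r j) ⟩
    d ^ r * (suc d * scaledExp (suc d) r j)    ≡⟨ lem' (suc d) (d ^ r) _ ⟩
    suc d * (d ^ r * scaledExp (suc d) r j)    ≤⟨ *-monoʳ-≤ (suc d) (scaledExp≤power d r j) ⟩
    suc d * (suc d ^ r * (suc d ^ j * j !))    ≡⟨ *-assoc (suc d) (suc d ^ r) _ ⟨
    suc d * suc d ^ r * (suc d ^ j * j !)      ∎
    where
    open ≤-Reasoning
    lem : ∀ a b c → a * b * c ≡ b * (a * c)
    lem = solve-∀
    lem' : ∀ a b c → b * (a * c) ≡ a * (b * c)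
    lem' = solve-∀

  -- The inequality (1+1/p)^p ≤ e raised to the power m. The series cut off at order `p * m` already
  -- dominates the power, so the hypothesis is applied at that order.
  ExpLe⇒power≤ : ∀ p .{{_ : NonZero p}} m N → ExpLe m N → suc p ^ (p * m) ≤ N * p ^ (p * m)
  ExpLe⇒power≤ p m N le = *-cancelʳ-≤ _ _ (q !) {{q !≢0}} (begin
    suc p ^ q * q !            ≤⟨ power≤scaledExp p q ⟩
    scaledExp p q q            ≡⟨ scaledExp-integral p m q ⟩
    p ^ q * expPartial m q     ≤⟨ *-monoʳ-≤ (p ^ q) (le q) ⟩
    p ^ q * (N * q !)          ≡⟨ lem (p ^ q) N (q !) ⟩
    N * p ^ q * q !            ∎)
    where
    open ≤-Reasoning
    q = p * m
    lem : ∀ a b c → a * (b * c) ≡ b * a * c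
    lem = solve-∀

  -- The inequality e ≤ (1+1/d)^(d+1) raised to the power m. The order j is dictated by the
  -- hypothesis, which is why the preceding bound is uniform in j.
  ExpGt⇒≤power : ∀ d m N → ExpGt m N → N * d ^ (suc d * m) ≤ suc d ^ (suc d * m)
  ExpGt⇒≤power d m N (j , lt) =
    *-cancelʳ-≤ _ _ (suc d ^ j * j !) {{m*n≢0 _ _ {{m^n≢0 (suc d) j}} {{j !≢0}}}} (begin
    N * d ^ r * (suc d ^ j * j !)              ≡⟨ lem N (d ^ r) (suc d ^ j) (j !) ⟩
    d ^ r * (suc d ^ j * (N * j !))            ≤⟨ *-monoʳ-≤ (d ^ r) (*-monoʳ-≤ (suc d ^ j) (<⇒≤ lt)) ⟩
    d ^ r * (suc d ^ j * expPartial m j)       ≡⟨ cong (d ^ r *_) (scaledExp-integral (suc d) m j) ⟨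
    d ^ r * scaledExp (suc d) r j              ≤⟨ scaledExp≤power d r j ⟩
    suc d ^ r * (suc d ^ j * j !)              ∎)
    where
    open ≤-Reasoning
    r = suc d * m
    lem : ∀ a b c e → a * b * (c * e) ≡ b * (c * (a * e))
    lem = solve-∀

  expPartial-mono : ∀ {m m′} j → m ≤ m′ → expPartial m j ≤ expPartial m′ j
  expPartial-mono zero    m≤m′ = ≤-refl
  expPartial-mono (suc j) m≤m′ =
    +-mono-≤ (*-monoʳ-≤ (suc j) (expPartial-mono j m≤m′)) (^-monoˡ-≤ (suc j) m≤m′)

  ExpLe-antitone : ∀ {m m′} N → m ≤ m′ → ExpLe m′ N → ExpLe m N
  ExpLe-antitone N m≤m′ le j = ≤-trans (expPartial-mono j m≤m′) (le j)

  ExpGt-mono : ∀ {m m′} N → m ≤ m′ → ExpGt m N → ExpGt m′ N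
  ExpGt-mono N m≤m′ (j , lt) = j , ≤-trans lt (expPartial-mono j m≤m′)

open ExponentialSeries

-- Growth of the weighted count W(n).

module CycleWeights where
  open import Data.Nat
  open import Data.Nat.Properties
  open import Function using (it)
  open import Data.Nat.Tactic.RingSolver using (solve-∀)
  open import Relation.Binary.PropositionalEquality

  -- C(m+2,2)
  pairCount : ℕ → ℕ
  pairCount zero    = 1
  pairCount (suc m) = (2 + m) + pairCount m

  2*pairCount : ∀ m → 2 * pairCount m ≡ (2 + m) * (1 + m)
  2*pairCount zero    = refl
  2*pairCount (suc m) = begin
    2 * (2 + m + pairCount m)          ≡⟨ *-distribˡ-+ 2 (2 + m) (pairCount m) ⟩
    2 * (2 + m) + 2 * pairCount m      ≡⟨ cong (2 * (2 + m) +_) (2*pairCount m) ⟩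
    2 * (2 + m) + (2 + m) * (1 + m)    ≡⟨ lem m ⟩
    (3 + m) * (2 + m)                  ∎
    where
    open ≡-Reasoning
    lem : ∀ m → 2 * (2 + m) + (2 + m) * (1 + m) ≡ (3 + m) * (2 + m)
    lem = solve-∀

  -- Σ a^c b^(n-c) over the 2-regular graphs on n vertices, c being the number of cycles.
  opaque
    cycleWeight : ℕ → ℕ → ℕ → ℕ
    cycleWeight a b 0 = 1
    cycleWeight a b 1 = 0
    cycleWeight a b 2 = 0
    cycleWeight a b (suc (suc (suc m))) =
      b * (2 + m) * cycleWeight a b (suc (suc m)) + a * (b * b) * pairCount m * cycleWeight a b m

    cycleWeight-0 : ∀ a b → cycleWeight a b 0 ≡ 1
    cycleWeight-0 a b = refl

    cycleWeight-1 : ∀ a b → cycleWeight a b 1 ≡ 0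
    cycleWeight-1 a b = refl

    cycleWeight-2 : ∀ a b → cycleWeight a b 2 ≡ 0
    cycleWeight-2 a b = refl

    cycleWeight-step : ∀ a b m → cycleWeight a b (3 + m) ≡
      b * (2 + m) * cycleWeight a b (2 + m) + a * (b * b) * pairCount m * cycleWeight a b m
    cycleWeight-step a b m = refl

  module _ (a b : ℕ) where
    private W = cycleWeight a b

    -- Only the insertion term of the recurrence is kept; for m ≤ 1 the left side vanishes.
    cycleWeight-suc-≥ : ∀ m → b * m * W m ≤ W (1 + m)
    cycleWeight-suc-≥ 0             rewrite *-zeroʳ b = z≤n
    cycleWeight-suc-≥ 1             rewrite cycleWeight-1 a b | *-zeroʳ (b * 1) = z≤n
    cycleWeight-suc-≥ (suc (suc m)) rewrite cycleWeight-step a b m = m≤m+n _ _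

    -- In other words W(m+3)/W(m+2) ≤ (m+2)(b + a/(2m)). The triangle term contains W(m), which two
    -- uses of the previous bound replace by W(m+2)/(b^2 m(m+1)).
    cycleWeight-suc-≤ : ∀ m → 2 * m * W (3 + m) ≤ (2 + m) * (2 * b * m + a) * W (2 + m)
    cycleWeight-suc-≤ m = begin
      2 * m * W (3 + m)
        ≡⟨ cong (2 * m *_) (cycleWeight-step a b m) ⟩
      2 * m * (b * (2 + m) * W₂ + a * (b * b) * pairCount m * W m)
        ≡⟨ expand m a b (pairCount m) W₂ (W m) ⟩
      2 * b * m * (2 + m) * W₂ + a * (b * b) * m * (2 * pairCount m) * W m
        ≡⟨ cong (λ c → 2 * b * m * (2 + m) * W₂ + a * (b * b) * m * c * W m) (2*pairCount m) ⟩
      2 * b * m * (2 + m) * W₂ + a * (b * b) * m * ((2 + m) * (1 + m)) * W m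
        ≡⟨ regroup m a b W₂ (W m) ⟩
      2 * b * m * (2 + m) * W₂ + a * (2 + m) * (b * (1 + m) * (b * m * W m))
        ≤⟨ +-monoʳ-≤ (2 * b * m * (2 + m) * W₂) (*-monoʳ-≤ (a * (2 + m)) W₀≤W₂) ⟩
      2 * b * m * (2 + m) * W₂ + a * (2 + m) * W₂
        ≡⟨ collect m a b W₂ ⟩
      (2 + m) * (2 * b * m + a) * W₂ ∎
      where
      open ≤-Reasoning
      W₂ = W (2 + m)
      W₀≤W₂ : b * (1 + m) * (b * m * W m) ≤ W₂
      W₀≤W₂ = ≤-trans (*-monoʳ-≤ (b * (1 + m)) (cycleWeight-suc-≥ m)) (cycleWeight-suc-≥ (1 + m))
      expand : ∀ m a b c x y → 2 * m * (b * (2 + m) * x + a * (b * b) * c * y)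
             ≡ 2 * b * m * (2 + m) * x + a * (b * b) * m * (2 * c) * y
      expand = solve-∀
      regroup : ∀ m a b x y → 2 * b * m * (2 + m) * x + a * (b * b) * m * ((2 + m) * (1 + m)) * y
             ≡ 2 * b * m * (2 + m) * x + a * (2 + m) * (b * (1 + m) * (b * m * y))
      regroup = solve-∀
      collect : ∀ m a b x → 2 * b * m * (2 + m) * x + a * (2 + m) * x
              ≡ (2 + m) * (2 * b * m + a) * x
      collect = solve-∀

    cycleWeight>0 : .{{_ : NonZero a}} .{{_ : NonZero b}} → ∀ m → 0 < W (3 + m)
    cycleWeight>0 zero    = begin-strict
      0                                <⟨ >-nonZero⁻¹ (a * (b * b)) {{m*n≢0 a (b * b) {{it}} {{m*n≢0 b b}}}} ⟩
      a * (b * b)                      ≡⟨ lem (a * (b * b)) ⟩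
      a * (b * b) * 1 * 1              ≡⟨ cong (a * (b * b) * 1 *_) (cycleWeight-0 a b) ⟨
      a * (b * b) * 1 * W 0            ≤⟨ m≤n+m _ _ ⟩
      b * 2 * W 2 + a * (b * b) * 1 * W 0 ≡⟨ cycleWeight-step a b 0 ⟨
      W 3                              ∎
      where
      open ≤-Reasoning
      lem : ∀ x → x ≡ x * 1 * 1
      lem = solve-∀
    cycleWeight>0 (suc m) = <-≤-trans
      (>-nonZero⁻¹ _ {{m*n≢0 (b * (3 + m)) (W (3 + m)) {{m*n≢0 b (3 + m)}} {{>-nonZero (cycleWeight>0 m)}}}})
      (cycleWeight-suc-≥ (3 + m))

  regularCount : ℕ → ℕ
  regularCount = cycleWeight 1 1

  -- A crude bound, made for comparing W(m+2) with W(m) in the sharper lower bound that follows.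
  regularCount-suc-≤ : ∀ m → regularCount (5 + m) ≤ (5 + m) * regularCount (4 + m)
  regularCount-suc-≤ m = *-cancelˡ-≤ (2 * (2 + m)) (begin
    2 * (2 + m) * regularCount (5 + m)                        ≤⟨ cycleWeight-suc-≤ 1 1 (2 + m) ⟩
    (4 + m) * (2 * 1 * (2 + m) + 1) * regularCount (4 + m)    ≤⟨ *-monoˡ-≤ (regularCount (4 + m)) coeff ⟩
    2 * (2 + m) * (5 + m) * regularCount (4 + m)              ≡⟨ *-assoc (2 * (2 + m)) (5 + m) (regularCount (4 + m)) ⟩
    2 * (2 + m) * ((5 + m) * regularCount (4 + m))            ∎)
    where
    open ≤-Reasoning
    lem : ∀ m → (4 + m) * (2 * 1 * (2 + m) + 1) + m ≡ 2 * (2 + m) * (5 + m)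
    lem = solve-∀
    coeff : (4 + m) * (2 * 1 * (2 + m) + 1) ≤ 2 * (2 + m) * (5 + m)
    coeff = ≤-trans (m≤m+n _ m) (≤-reflexive (lem m))

  -- At x = 1 the growth factor is at least (m+2) + 1/2. The half is the triangle term: two crude
  -- bounds, valid from index 4 on, show C(m+2,2) W(m) ≥ W(m+2)/2.
  regularCount-suc-≥ : ∀ m → 4 ≤ m →
    (2 * (2 + m) + 1) * regularCount (2 + m) ≤ 2 * regularCount (3 + m)
  regularCount-suc-≥ m@(suc (suc (suc (suc l)))) (s≤s (s≤s (s≤s (s≤s _)))) = begin
    (2 * (2 + m) + 1) * A₂                            ≡⟨ split m A₂ ⟩
    2 * (1 * (2 + m) * A₂) + A₂                       ≤⟨ +-monoʳ-≤ _ A₂≤A₀ ⟩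
    2 * (1 * (2 + m) * A₂) + (2 + m) * (1 + m) * A₀   ≡⟨ cong (λ c → 2 * (1 * (2 + m) * A₂) + c * A₀) (2*pairCount m) ⟨
    2 * (1 * (2 + m) * A₂) + 2 * pairCount m * A₀     ≡⟨ join (1 * (2 + m) * A₂) (pairCount m) A₀ ⟩
    2 * (1 * (2 + m) * A₂ + 1 * (1 * 1) * pairCount m * A₀)
                                                      ≡⟨ cong (2 *_) (cycleWeight-step 1 1 m) ⟨
    2 * regularCount (3 + m)                          ∎
    where
    open ≤-Reasoning
    A₀ = regularCount m
    A₂ = regularCount (2 + m)
    split : ∀ m x → (2 * (2 + m) + 1) * x ≡ 2 * (1 * (2 + m) * x) + x
    split = solve-∀
    join : ∀ x c y → 2 * x + 2 * c * y ≡ 2 * (x + 1 * (1 * 1) * c * y)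
    join = solve-∀
    A₂≤A₀ : A₂ ≤ (2 + m) * (1 + m) * A₀
    A₂≤A₀ = begin
      A₂                                 ≤⟨ regularCount-suc-≤ (1 + l) ⟩
      (2 + m) * regularCount (1 + m)     ≤⟨ *-monoʳ-≤ (2 + m) (regularCount-suc-≤ l) ⟩
      (2 + m) * ((1 + m) * A₀)           ≡⟨ *-assoc (2 + m) (1 + m) A₀ ⟨
      (2 + m) * (1 + m) * A₀             ∎

  -- The quotient of `cycleWeight a b n` by b^n `regularCount n` changes by a factor of at most d/c
  -- from n = m + 2 to m + 3. The upper growth bound serves its numerator, the lower one its
  -- denominator.
  cycleWeight-ratio : ∀ a b c d m → 4 ≤ m →
    (2 + m) * (2 * b * m + a) * c ≤ b * m * (2 * (2 + m) + 1) * d →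
    c * cycleWeight a b (3 + m) * regularCount (2 + m) ≤
    d * cycleWeight a b (2 + m) * (b * regularCount (3 + m))
  cycleWeight-ratio a b c d m 4≤m bound =
    *-cancelˡ-≤ (2 * m * (2 * (2 + m) + 1)) {{nz}} (begin
    2 * m * s * (c * X′ * A)                  ≡⟨ e₁ m s c X′ A ⟩
    2 * m * X′ * (c * (s * A))                ≤⟨ *-mono-≤ (cycleWeight-suc-≤ a b m) (*-monoʳ-≤ c (regularCount-suc-≥ m 4≤m)) ⟩
    r * X * (c * (2 * A′))                    ≡⟨ e₂ r X c A′ ⟩
    r * c * (2 * X * A′)                      ≤⟨ *-monoˡ-≤ (2 * X * A′) bound ⟩
    b * m * s * d * (2 * X * A′)              ≡⟨ e₃ b m s d X A′ ⟩
    2 * m * s * (d * X * (b * A′))            ∎)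
    where
    open ≤-Reasoning
    s  = 2 * (2 + m) + 1
    r  = (2 + m) * (2 * b * m + a)
    X  = cycleWeight a b (2 + m)
    X′ = cycleWeight a b (3 + m)
    A  = regularCount (2 + m)
    A′ = regularCount (3 + m)
    nz : NonZero (2 * m * s)
    nz = m*n≢0 (2 * m) s {{m*n≢0 2 m {{_}} {{>-nonZero (≤-trans (s≤s z≤n) 4≤m)}}}} {{>-nonZero (m≤n+m 1 (2 * (2 + m)))}}
    e₁ : ∀ m s c x y → 2 * m * s * (c * x * y) ≡ 2 * m * x * (c * (s * y))
    e₁ = solve-∀
    e₂ : ∀ r x c y → r * x * (c * (2 * y)) ≡ r * c * (2 * x * y)
    e₂ = solve-∀
    e₃ : ∀ b m s d x y → b * m * s * d * (2 * x * y) ≡ 2 * m * s * (d * x * (b * y))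
    e₃ = solve-∀

  ^-cancelʳ-≤ : ∀ k .{{_ : NonZero k}} {m n} → m ^ k ≤ n ^ k → m ≤ n
  ^-cancelʳ-≤ k {m} {n} le = ≮⇒≥ λ n<m → <⇒≱ (^-monoˡ-< k n<m) le

  -- If x/y changes by at most d/c, then (x/y)^g changes by at most (d/c)^g ≤ r/s. With r/s equal to
  -- (n+1)/n or its inverse, telescoping yields the order n^(1/g) or n^(-1/g) without roots.
  power-ratio : ∀ g c d r s x x′ y y′ .{{_ : NonZero c}} → c * x′ * y ≤ d * x * y′ →
                d ^ g * s ≤ c ^ g * r → x′ ^ g * s * y ^ g ≤ x ^ g * r * y′ ^ g
  power-ratio g c d r s x x′ y y′ ratio dc = *-cancelˡ-≤ (c ^ g) {{m^n≢0 c g}} (begin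
    c ^ g * (x′ ^ g * s * y ^ g)   ≡⟨ e₁ (c ^ g) (x′ ^ g) s (y ^ g) ⟩
    c ^ g * x′ ^ g * y ^ g * s     ≡⟨ cong (_* s) (distrib₃ c x′ y) ⟨
    (c * x′ * y) ^ g * s           ≤⟨ *-monoˡ-≤ s (^-monoˡ-≤ g ratio) ⟩
    (d * x * y′) ^ g * s           ≡⟨ cong (_* s) (distrib₃ d x y′) ⟩
    d ^ g * x ^ g * y′ ^ g * s     ≡⟨ e₂ (d ^ g) (x ^ g) (y′ ^ g) s ⟩
    d ^ g * s * (x ^ g * y′ ^ g)   ≤⟨ *-monoˡ-≤ (x ^ g * y′ ^ g) dc ⟩
    c ^ g * r * (x ^ g * y′ ^ g)   ≡⟨ e₃ (c ^ g) r (x ^ g) (y′ ^ g) ⟩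
    c ^ g * (x ^ g * r * y′ ^ g)   ∎)
    where
    open ≤-Reasoning
    distrib₃ : ∀ u v w → (u * v * w) ^ g ≡ u ^ g * v ^ g * w ^ g
    distrib₃ u v w = trans (^-distribʳ-* g (u * v) w) (cong (_* w ^ g) (^-distribʳ-* g u v))
    e₁ : ∀ c x s y → c * (x * s * y) ≡ c * x * y * s
    e₁ = solve-∀
    e₂ : ∀ c x y s → c * x * y * s ≡ c * s * (x * y)
    e₂ = solve-∀
    e₃ : ∀ c r x y → c * r * (x * y) ≡ c * (x * r * y)
    e₃ = solve-∀

  -- The quotient F/G does not increase from n₀ on; since G n₀ ≥ 1, the value F n₀ serves as the
  -- constant.
  telescope : (F G : ℕ → ℕ) (n₀ : ℕ) → (∀ n → n₀ ≤ n → 0 < G n) →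
              (∀ n → n₀ ≤ n → F (suc n) * G n ≤ F n * G (suc n)) →
              ∀ n → n₀ ≤ n → F n ≤ F n₀ * G n
  telescope F G n₀ pos step n n₀≤n = go n (≤⇒≤′ n₀≤n)
    where
    open ≤-Reasoning
    lem : ∀ f x y → f * x * y ≡ f * y * x
    lem = solve-∀
    go : ∀ n → n₀ ≤′ n → F n ≤ F n₀ * G n
    go n (≤′-reflexive refl) = m≤m*n (F n₀) (G n₀) {{>-nonZero (pos n₀ ≤-refl)}}
    go (suc n) (≤′-step le) = *-cancelʳ-≤ _ _ (G n) {{>-nonZero (pos n (≤′⇒≤ le))}} (begin
      F (suc n) * G n             ≤⟨ step n (≤′⇒≤ le) ⟩
      F n * G (suc n)             ≤⟨ *-monoˡ-≤ (G (suc n)) (go n le) ⟩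
      F n₀ * G n * G (suc n)      ≡⟨ lem (F n₀) (G n) (G (suc n)) ⟩
      F n₀ * G (suc n) * G n      ∎)

  linear≤square : ∀ c₁ c₀ m → c₁ + c₀ ≤ m → c₁ * m + c₀ ≤ m * m
  linear≤square c₁ c₀ zero      le rewrite *-zeroʳ c₁ = ≤-trans (m≤n+m c₀ c₁) le
  linear≤square c₁ c₀ m@(suc _) le = begin
    c₁ * m + c₀      ≤⟨ +-monoʳ-≤ (c₁ * m) (m≤m*n c₀ m) ⟩
    c₁ * m + c₀ * m  ≡⟨ *-distribʳ-+ m c₁ c₀ ⟨
    (c₁ + c₀) * m    ≤⟨ *-monoˡ-≤ m le ⟩
    m * m            ∎
    where open ≤-Reasoning

  -- For polynomial inequalities that hold for large m: the ring solver supplies an identity saying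
  -- r - l = m^2 - c₁ m - c₀, and this is nonnegative once m ≥ c₁ + c₀.
  ≤-from-square : ∀ {l r} c₁ c₀ m → c₁ + c₀ ≤ m → l + m * m ≡ r + (c₁ * m + c₀) → l ≤ r
  ≤-from-square {l} {r} c₁ c₀ m le eq = +-cancelʳ-≤ (m * m) l r (begin
    l + m * m            ≡⟨ eq ⟩
    r + (c₁ * m + c₀)    ≤⟨ +-monoʳ-≤ r (linear≤square c₁ c₀ m le) ⟩
    r + m * m            ∎)
    where open ≤-Reasoning

open CycleWeights

-- From estimates with roots to inequalities between integers.

module PowerComparison where
  open import Data.Nat
  open import Data.Nat.Properties
  open import Data.Nat.Tactic.RingSolver using (solve-∀)
  open import Relation.Binary.PropositionalEquality

  -- Up to constants, x/y ≤ n^((f-e)/g) and u/v ≤ n^((f′-e′)/Q). Both are raised to the power gQ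
  -- to avoid roots, and the spare factor n in the exponents absorbs the constants.
  combine-powers : ∀ g Q .{{_ : NonZero g}} .{{_ : NonZero Q}} e e′ f f′ n D C x y u v .{{_ : NonZero n}} →
    x ^ g * n ^ e ≤ C * n ^ f * y ^ g →
    n ^ e′ * u ^ Q ≤ n ^ f′ * v ^ Q →
    D ^ (g * Q) * C ^ Q ≤ n →
    1 + (f * Q + f′ * g) ≤ e * Q + e′ * g →
    D * x * u ≤ v * y
  combine-powers g Q e e′ f f′ n D C x y u v xy uv large exponents =
    ^-cancelʳ-≤ G {{m*n≢0 g Q}} (*-cancelʳ-≤ _ _ (n ^ (e * Q + e′ * g)) {{m^n≢0 n (e * Q + e′ * g)}} (begin
    (D * x * u) ^ G * n ^ (e * Q + e′ * g)
      ≡⟨ cong₂ _*_ (distrib₃ D x u) (split-n e e′) ⟩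
    D ^ G * (x ^ g) ^ Q * (u ^ Q) ^ g * ((n ^ e) ^ Q * (n ^ e′) ^ g)
      ≡⟨ e₁ (D ^ G) ((x ^ g) ^ Q) ((u ^ Q) ^ g) ((n ^ e) ^ Q) ((n ^ e′) ^ g) ⟩
    D ^ G * ((x ^ g) ^ Q * (n ^ e) ^ Q) * ((n ^ e′) ^ g * (u ^ Q) ^ g)
      ≡⟨ cong₂ (λ a b → D ^ G * a * b) (^-distribʳ-* Q (x ^ g) (n ^ e)) (^-distribʳ-* g (n ^ e′) (u ^ Q)) ⟨
    D ^ G * (x ^ g * n ^ e) ^ Q * (n ^ e′ * u ^ Q) ^ g
      ≤⟨ *-mono-≤ (*-monoʳ-≤ (D ^ G) (^-monoˡ-≤ Q xy)) (^-monoˡ-≤ g uv) ⟩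
    D ^ G * (C * n ^ f * y ^ g) ^ Q * (n ^ f′ * v ^ Q) ^ g
      ≡⟨ cong₂ (λ a b → D ^ G * a * b)
           (trans (^-distribʳ-* Q (C * n ^ f) (y ^ g)) (cong (_* (y ^ g) ^ Q) (^-distribʳ-* Q C (n ^ f))))
           (^-distribʳ-* g (n ^ f′) (v ^ Q)) ⟩
    D ^ G * (C ^ Q * (n ^ f) ^ Q * (y ^ g) ^ Q) * ((n ^ f′) ^ g * (v ^ Q) ^ g)
      ≡⟨ e₂ (D ^ G) (C ^ Q) ((n ^ f) ^ Q) ((y ^ g) ^ Q) ((n ^ f′) ^ g) ((v ^ Q) ^ g) ⟩
    D ^ G * C ^ Q * ((n ^ f) ^ Q * (n ^ f′) ^ g) * ((v ^ Q) ^ g * (y ^ g) ^ Q)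
      ≡⟨ cong (λ a → D ^ G * C ^ Q * a * ((v ^ Q) ^ g * (y ^ g) ^ Q)) (split-n f f′) ⟨
    D ^ G * C ^ Q * n ^ (f * Q + f′ * g) * ((v ^ Q) ^ g * (y ^ g) ^ Q)
      ≤⟨ *-monoˡ-≤ ((v ^ Q) ^ g * (y ^ g) ^ Q) (≤-trans (*-monoˡ-≤ (n ^ (f * Q + f′ * g)) large) (^-monoʳ-≤ n exponents)) ⟩
    n ^ (e * Q + e′ * g) * ((v ^ Q) ^ g * (y ^ g) ^ Q)
      ≡⟨ *-comm (n ^ (e * Q + e′ * g)) _ ⟩
    (v ^ Q) ^ g * (y ^ g) ^ Q * n ^ (e * Q + e′ * g)
      ≡⟨ cong (_* n ^ (e * Q + e′ * g)) distrib₂ ⟨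
    (v * y) ^ G * n ^ (e * Q + e′ * g) ∎))
    where
    open ≤-Reasoning
    G = g * Q
    swap : ∀ w → w ^ G ≡ (w ^ Q) ^ g
    swap w = trans (cong (w ^_) (*-comm g Q)) (sym (^-*-assoc w Q g))
    split-n : ∀ i j → n ^ (i * Q + j * g) ≡ (n ^ i) ^ Q * (n ^ j) ^ g
    split-n i j = trans (^-distribˡ-+-* n (i * Q) (j * g))
                        (cong₂ _*_ (sym (^-*-assoc n i Q)) (sym (^-*-assoc n j g)))
    distrib₂ : (v * y) ^ G ≡ (v ^ Q) ^ g * (y ^ g) ^ Q
    distrib₂ = trans (^-distribʳ-* G v y) (cong₂ _*_ (swap v) (sym (^-*-assoc y g Q)))
    distrib₃ : ∀ a b c → (a * b * c) ^ G ≡ a ^ G * (b ^ g) ^ Q * (c ^ Q) ^ g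
    distrib₃ a b c = trans (^-distribʳ-* G (a * b) c) (cong₂ _*_
      (trans (^-distribʳ-* G a b) (cong (a ^ G *_) (sym (^-*-assoc b g Q)))) (swap c))
    e₁ : ∀ d x u p q → d * x * u * (p * q) ≡ d * (x * p) * (q * u)
    e₁ = solve-∀
    e₂ : ∀ d c p y q v → d * (c * p * y) * (q * v) ≡ d * c * (p * q) * (v * y)
    e₂ = solve-∀

  cube : ∀ x k → (x ^ k) ^ 3 ≡ x ^ (3 * k)
  cube x k = trans (^-*-assoc x k 3) (cong (x ^_) (*-comm k 3))

  cube-product : ∀ n i a r → (n ^ i * a ^ r) ^ 3 ≡ n ^ (3 * i) * a ^ (3 * r)
  cube-product n i a r = trans (^-distribʳ-* 3 (n ^ i) (a ^ r)) (cong₂ _*_ (cube n i) (cube a r))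

  -- The threshold exponents `3 * t` and `3 * (t + 2)` and the size 3c of a smallest feasible set
  -- all carry a factor 3; cube roots remove it.
  cube-rootˡ : ∀ n i a b r → n ^ (3 * i) * a ^ (3 * r) ≤ b ^ (3 * r) → n ^ i * a ^ r ≤ b ^ r
  cube-rootˡ n i a b r le = ^-cancelʳ-≤ 3 (subst₂ _≤_ (sym (cube-product n i a r)) (sym (cube b r)) le)

  cube-rootʳ : ∀ n i a b r → b ^ (3 * r) ≤ n ^ (3 * i) * a ^ (3 * r) → b ^ r ≤ n ^ i * a ^ r
  cube-rootʳ n i a b r le = ^-cancelʳ-≤ 3 (subst₂ _≤_ (sym (cube b r)) (sym (cube-product n i a r)) le)

  -- The weight w = a^k b^(n-k) enters through `w * b ^ k ≡ a ^ k * b ^ n`, which avoids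
  -- subtraction.
  cancel-weight : ∀ a b n k w D X A .{{_ : NonZero b}} → w * b ^ k ≡ a ^ k * b ^ n →
                  D * X * b ^ k ≤ a ^ k * (b ^ n * A) → D * X ≤ w * A
  cancel-weight a b n k w D X A wk le = *-cancelʳ-≤ _ _ (b ^ k) {{m^n≢0 b k}} (begin
    D * X * b ^ k          ≤⟨ le ⟩
    a ^ k * (b ^ n * A)    ≡⟨ *-assoc (a ^ k) (b ^ n) A ⟨
    a ^ k * b ^ n * A      ≡⟨ cong (_* A) wk ⟨
    w * b ^ k * A          ≡⟨ e w (b ^ k) A ⟩
    w * A * b ^ k          ∎)
    where
    open ≤-Reasoning
    e : ∀ w p x → w * p * x ≡ w * x * p
    e = solve-∀

  -- With the factor b^n in the unweighted count, the quotient of the two totals is the mean of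
  -- (a/b)^c over the 2-regular graphs.
  scaled-ratio : ∀ a b c d m → 4 ≤ m →
    (2 + m) * (2 * b * m + a) * c ≤ b * m * (2 * (2 + m) + 1) * d →
    c * cycleWeight a b (3 + m) * (b ^ (2 + m) * regularCount (2 + m)) ≤
    d * cycleWeight a b (2 + m) * (b ^ (3 + m) * regularCount (3 + m))
  scaled-ratio a b c d m 4≤m bound = begin
    c * X′ * (B * A)          ≡⟨ e₁ c X′ B A ⟩
    c * X′ * A * B            ≤⟨ *-monoˡ-≤ B (cycleWeight-ratio a b c d m 4≤m bound) ⟩
    d * X * (b * A′) * B      ≡⟨ e₂ d X b A′ B ⟩
    d * X * (b * B * A′)      ∎
    where
    open ≤-Reasoning
    X  = cycleWeight a b (2 + m)
    X′ = cycleWeight a b (3 + m)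
    A  = regularCount (2 + m)
    A′ = regularCount (3 + m)
    B  = b ^ (2 + m)
    e₁ : ∀ c x p y → c * x * (p * y) ≡ c * x * y * p
    e₁ = solve-∀
    e₂ : ∀ d x b y p → d * x * (b * y) * p ≡ d * x * (b * p * y)
    e₂ = solve-∀

  scaledCount>0 : ∀ b .{{_ : NonZero b}} m → 4 ≤ m → 0 < b ^ (2 + m) * regularCount (2 + m)
  scaledCount>0 b (suc m) _ =
    >-nonZero⁻¹ _ {{m*n≢0 _ _ {{m^n≢0 b (3 + m)}} {{>-nonZero (cycleWeight>0 1 1 m)}}}}

open PowerComparison

-- Codes with too many or too few cycles weigh far more than the average.

module TailBounds where
  open import Defs
  open import Data.Nat
  open import Data.Nat.Properties
  open import Data.Nat.Tactic.RingSolver using (solve-∀)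
  open import Data.Product using (_,_; ∃-syntax; _×_)
  open import Relation.Binary.PropositionalEquality

  -- Bernoulli's inequality for the inverses: (1 - 1/(M+1))^(g+1) ≥ 1 - (g+1)/(M+1) = n/(n+1).
  [1+1/M]^g≤1+1/n : ∀ g n M → suc M ≡ suc g * suc n → suc M ^ suc g * n ≤ M ^ suc g * suc n
  [1+1/M]^g≤1+1/n g n M eq = +-cancelˡ-≤ (suc M * S) _ _ (begin
    suc M * S + suc M * S * n                  ≡⟨ e₁ (suc M * S) n ⟩
    suc M * S * suc n                          ≤⟨ *-monoˡ-≤ (suc n) (bernoulli-upper M g) ⟩
    (M ^ suc g + suc g * S) * suc n            ≡⟨ e₂ (M ^ suc g) (suc g) S (suc n) ⟩
    suc g * suc n * S + M ^ suc g * suc n      ≡⟨ cong (λ x → x * S + M ^ suc g * suc n) eq ⟨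
    suc M * S + M ^ suc g * suc n              ∎)
    where
    open ≤-Reasoning
    S = suc M ^ g
    e₁ : ∀ x n → x + x * n ≡ x * suc n
    e₁ = solve-∀
    e₂ : ∀ x g s n → (x + g * s) * n ≡ g * n * s + x * n
    e₂ = solve-∀

  1+1/n≤[1+1/gn]^g : ∀ g n → (suc g * n) ^ suc g * suc n ≤ suc (suc g * n) ^ suc g * n
  1+1/n≤[1+1/gn]^g g n = begin
    M * M ^ g * suc n                ≡⟨ e (suc g) n (M ^ g) ⟩
    (M * M ^ g + suc g * M ^ g) * n  ≤⟨ *-monoˡ-≤ n (bernoulli-lower M g) ⟩
    suc M ^ suc g * n                ∎
    where
    open ≤-Reasoning
    M = suc g * n
    e : ∀ g n x → g * n * x * suc n ≡ (g * n * x + g * x) * n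
    e = solve-∀

  ≥-split : ∀ l {n} → l + 2 ≤ n → ∃[ m ] (l ≤ m × n ≡ 2 + m)
  ≥-split l {n} le rewrite +-comm l 2 with n | le
  ... | suc (suc m) | s≤s (s≤s l≤m) = m , l≤m , refl

  -- Here x = a/b = 1 + 1/b. The exact exponent of n in the ratio of weights is 1/(2b); replacing it
  -- by 1/g with g = 2b - 1 absorbs the lower order terms, and b = 2t + 3 is large enough for 1/g to
  -- stay below the exponent (t + 2)/Q supplied by the deviation hypothesis.
  upper-tail : ∀ t → ∃[ N ] (∀ n → N ≤ n → ∀ k w →
    w * (3 + 2 * t) ^ k ≡ (4 + 2 * t) ^ k * (3 + 2 * t) ^ n →
    ExpGt (2 * suc t * (3 * k)) (n ^ (3 * (t + 2))) →
    2 * suc t * cycleWeight (4 + 2 * t) (3 + 2 * t) n ≤ w * regularCount n)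
  upper-tail t = N , main
    where
    b = 3 + 2 * t
    a = suc b
    -- Naming the predecessor of g lets h + g n stand for g(n+1) - 1 without subtraction.
    h = 4 + 4 * t
    g = suc h
    -- After the cube root, e ≤ (a/b)^a turns e^(D k) > n^(t+2) into (a/b)^(k Q) ≥ n^(t+2).
    Q = 2 * suc t * a
    D = 2 * suc t
    X Y F G : ℕ → ℕ
    X = cycleWeight a b
    Y n = b ^ n * regularCount n
    -- F/G is (X/Y)^g / n; if it does not increase, the mean X/Y of x^c is O(n^(1/g)).
    F n = X n ^ g
    G n = n * Y n ^ g
    c₁ = 16 * (t * t) + 54 * t + 39
    c₀ = 48 * (t * t) + 152 * t + 112
    -- With n = 2 + m, this makes m large enough for `coefficients` and at least 4, as the lower
    -- bound on the unweighted count requires.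
    n₀ = c₁ + c₀ + 4 + 2
    C = F n₀
    -- From here on the spare factor n outweighs the constant C of the telescoping and the factor D.
    N = n₀ + D ^ (g * Q) * C ^ Q

    coefficients : ∀ m → c₁ + c₀ ≤ m →
      (2 + m) * (2 * b * m + a) * (h + g * (2 + m)) ≤ b * m * (2 * (2 + m) + 1) * suc (h + g * (2 + m))
    -- The permitted growth is about 1 + 1/(g n), the actual one about 1 + 1/(2 b n). Because g = 2b
    -- - 1, the surplus after clearing denominators is m^2 minus the lower order terms c₁ m + c₀.
    coefficients m le = ≤-from-square c₁ c₀ m le (e t m)
      where
      e : ∀ t m → (2 + m) * (2 * (3 + 2 * t) * m + (4 + 2 * t)) * (4 + 4 * t + suc (4 + 4 * t) * (2 + m)) + m * m
        ≡ (3 + 2 * t) * m * (2 * (2 + m) + 1) * suc (4 + 4 * t + suc (4 + 4 * t) * (2 + m))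
          + ((16 * (t * t) + 54 * t + 39) * m + (48 * (t * t) + 152 * t + 112))
      e = solve-∀

    positive : ∀ n → n₀ ≤ n → 0 < G n
    positive n n₀≤n with m , le , refl ← ≥-split (c₁ + c₀ + 4) n₀≤n =
      >-nonZero⁻¹ _ {{m*n≢0 (2 + m) _ {{_}} {{m^n≢0 _ g {{>-nonZero (scaledCount>0 b m (≤-trans (m≤n+m 4 _) le))}}}}}}

    step : ∀ n → n₀ ≤ n → F (suc n) * G n ≤ F n * G (suc n)
    step n n₀≤n with m , le , refl ← ≥-split (c₁ + c₀ + 4) n₀≤n = begin
      F (3 + m) * (n * Y n ^ g)          ≡⟨ *-assoc (F (3 + m)) n (Y n ^ g) ⟨
      F (3 + m) * n * Y n ^ g            ≤⟨ power-ratio g (h + g * n) (suc (h + g * n)) (suc n) n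
                                              (X n) (X (suc n)) (Y n) (Y (suc n))
                                              (scaled-ratio a b (h + g * n) (suc (h + g * n)) m (≤-trans (m≤n+m 4 _) le)
                                                (coefficients m (≤-trans (m≤m+n _ 4) le)))
                                              ([1+1/M]^g≤1+1/n h n (h + g * n) (e g n)) ⟩
      F n * suc n * Y (suc n) ^ g        ≡⟨ *-assoc (F n) (suc n) (Y (suc n) ^ g) ⟩
      F n * G (suc n)                    ∎
      where
      open ≤-Reasoning
      e : ∀ g n → g + g * n ≡ g * suc n
      e = solve-∀

    main : ∀ n → N ≤ n → ∀ k w → w * b ^ k ≡ a ^ k * b ^ n →
           ExpGt (2 * suc t * (3 * k)) (n ^ (3 * (t + 2))) → D * X n ≤ w * regularCount n
    main n N≤n k w wk gt = cancel-weight a b n k w D (X n) (regularCount n) wk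
      (combine-powers g Q 0 (t + 2) 1 0 n D C (X n) (Y n) (b ^ k) (a ^ k) {{n≢0}} xy uv (≤-trans (m≤n+m _ n₀) N≤n) exponents)
      where
      open ≤-Reasoning
      n₀≤n : n₀ ≤ n
      n₀≤n = ≤-trans (m≤m+n n₀ _) N≤n
      n≢0 : NonZero n
      n≢0 = >-nonZero (≤-trans (≤-trans (s≤s z≤n) (m≤n+m 2 (c₁ + c₀ + 4))) n₀≤n)
      xy : X n ^ g * n ^ 0 ≤ C * n ^ 1 * Y n ^ g
      xy = begin
        X n ^ g * 1              ≡⟨ *-identityʳ _ ⟩
        F n                      ≤⟨ telescope F G n₀ positive step n n₀≤n ⟩
        C * (n * Y n ^ g)        ≡⟨ e C n (Y n ^ g) ⟩
        C * (n * 1) * Y n ^ g    ∎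
        where
        e : ∀ c n y → c * (n * y) ≡ c * (n * 1) * y
        e = solve-∀
      uv : n ^ (t + 2) * (b ^ k) ^ Q ≤ n ^ 0 * (a ^ k) ^ Q
      uv = begin
        n ^ (t + 2) * (b ^ k) ^ Q   ≡⟨ cong (n ^ (t + 2) *_) (^-*-assoc b k Q) ⟩
        n ^ (t + 2) * b ^ (k * Q)   ≤⟨ cube-rootˡ n (t + 2) b a (k * Q)
                                         (subst (λ j → n ^ (3 * (t + 2)) * b ^ j ≤ a ^ j) (e a D k)
                                           (ExpGt⇒≤power b (D * (3 * k)) (n ^ (3 * (t + 2))) gt)) ⟩
        a ^ (k * Q)                 ≡⟨ ^-*-assoc a k Q ⟨
        (a ^ k) ^ Q                 ≡⟨ *-identityˡ _ ⟨
        1 * (a ^ k) ^ Q             ∎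
        where
        e : ∀ a d k → a * (d * (3 * k)) ≡ 3 * (k * (d * a))
        e = solve-∀
      -- Here Q = 4(t+1)(t+2) and g = 4t + 5, so (t+2) g exceeds Q by t + 2; one unit of it is the
      -- spare factor n.
      exponents : 1 + (1 * Q + 0 * g) ≤ 0 * Q + (t + 2) * g
      exponents = ≤-trans (m≤m+n _ (1 + t)) (≤-reflexive (e t))
        where
        e : ∀ t → 1 + (1 * (2 * suc t * (4 + 2 * t)) + 0) + (1 + t) ≡ (t + 2) * suc (4 + 4 * t)
        e = solve-∀

  -- Here x = a/b = 1 - 1/b, and g = 2b + 1 plays the same role for the exponent -1/(2b).
  lower-tail : ∀ t → ∃[ N ] (∀ n → N ≤ n → ∀ k w →
    w * (4 + 2 * t) ^ k ≡ (3 + 2 * t) ^ k * (4 + 2 * t) ^ n →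
    ExpLe (2 * suc t * (3 * k)) (n ^ (3 * t)) →
    2 * suc t * cycleWeight (3 + 2 * t) (4 + 2 * t) n ≤ w * regularCount n)
  lower-tail t = N , main
    where
    a = 3 + 2 * t
    b = suc a
    h = 8 + 4 * t
    g = suc h
    -- Now b/a = 1 + 1/a, and (1+1/a)^a ≤ e turns e^(D k) ≤ n^t into (b/a)^(k Q) ≤ n^t.
    Q = 2 * suc t * a
    D = 2 * suc t
    X Y F G : ℕ → ℕ
    X = cycleWeight a b
    Y n = b ^ n * regularCount n
    -- As x < 1, the mean X/Y decays; the factor n therefore stands on the side of X, and the
    -- outcome is X/Y = O(n^(-1/g)).
    F n = X n ^ g * n
    G n = Y n ^ g
    c₁ = 16 * (t * t) + 62 * t + 55
    c₀ = 32 * (t * t) + 124 * t + 114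
    n₀ = c₁ + c₀ + 4 + 2
    C = F n₀
    N = n₀ + D ^ (g * Q) * C ^ Q

    coefficients : ∀ m → c₁ + c₀ ≤ m →
      (2 + m) * (2 * b * m + a) * suc (g * (2 + m)) ≤ b * m * (2 * (2 + m) + 1) * (g * (2 + m))
    coefficients m le = ≤-from-square c₁ c₀ m le (e t m)
      where
      e : ∀ t m → (2 + m) * (2 * (4 + 2 * t) * m + (3 + 2 * t)) * suc (suc (8 + 4 * t) * (2 + m)) + m * m
        ≡ (4 + 2 * t) * m * (2 * (2 + m) + 1) * (suc (8 + 4 * t) * (2 + m))
          + ((16 * (t * t) + 62 * t + 55) * m + (32 * (t * t) + 124 * t + 114))
      e = solve-∀

    positive : ∀ n → n₀ ≤ n → 0 < G n
    positive n n₀≤n with m , le , refl ← ≥-split (c₁ + c₀ + 4) n₀≤n =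
      >-nonZero⁻¹ _ {{m^n≢0 _ g {{>-nonZero (scaledCount>0 b m (≤-trans (m≤n+m 4 _) le))}}}}

    step : ∀ n → n₀ ≤ n → F (suc n) * G n ≤ F n * G (suc n)
    step n n₀≤n with m , le , refl ← ≥-split (c₁ + c₀ + 4) n₀≤n =
      power-ratio g (suc (g * n)) (g * n) n (suc n) (X n) (X (suc n)) (Y n) (Y (suc n))
        (scaled-ratio a b (suc (g * n)) (g * n) m (≤-trans (m≤n+m 4 _) le) (coefficients m (≤-trans (m≤m+n _ 4) le)))
        (1+1/n≤[1+1/gn]^g h n)

    main : ∀ n → N ≤ n → ∀ k w → w * b ^ k ≡ a ^ k * b ^ n →
           ExpLe (2 * suc t * (3 * k)) (n ^ (3 * t)) → D * X n ≤ w * regularCount n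
    main n N≤n k w wk le = cancel-weight a b n k w D (X n) (regularCount n) wk
      (combine-powers g Q 1 0 0 t n D C (X n) (Y n) (b ^ k) (a ^ k) {{n≢0}} xy uv (≤-trans (m≤n+m _ n₀) N≤n) exponents)
      where
      open ≤-Reasoning
      n₀≤n : n₀ ≤ n
      n₀≤n = ≤-trans (m≤m+n n₀ _) N≤n
      n≢0 : NonZero n
      n≢0 = >-nonZero (≤-trans (≤-trans (s≤s z≤n) (m≤n+m 2 (c₁ + c₀ + 4))) n₀≤n)
      xy : X n ^ g * n ^ 1 ≤ C * n ^ 0 * Y n ^ g
      xy = begin
        X n ^ g * (n * 1)        ≡⟨ cong (X n ^ g *_) (*-identityʳ n) ⟩
        F n                      ≤⟨ telescope F G n₀ positive step n n₀≤n ⟩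
        C * Y n ^ g              ≡⟨ cong (_* Y n ^ g) (*-identityʳ C) ⟨
        C * 1 * Y n ^ g          ∎
      uv : n ^ 0 * (b ^ k) ^ Q ≤ n ^ t * (a ^ k) ^ Q
      uv = begin
        1 * (b ^ k) ^ Q          ≡⟨ *-identityˡ _ ⟩
        (b ^ k) ^ Q              ≡⟨ ^-*-assoc b k Q ⟩
        b ^ (k * Q)              ≤⟨ cube-rootʳ n t a b (k * Q)
                                      (subst (λ j → b ^ j ≤ n ^ (3 * t) * a ^ j) (e a D k)
                                        (ExpLe⇒power≤ a (D * (3 * k)) (n ^ (3 * t)) le)) ⟩
        n ^ t * a ^ (k * Q)      ≡⟨ cong (n ^ t *_) (^-*-assoc a k Q) ⟨
        n ^ t * (a ^ k) ^ Q      ∎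
        where
        e : ∀ a d k → a * (d * (3 * k)) ≡ 3 * (k * (d * a))
        e = solve-∀
      -- Here Q - t g = t + 6, so x^c, which is at least n^(-t/Q), stays above the mean of order
      -- n^(-1/g).
      exponents : 1 + (0 * Q + t * g) ≤ 1 * Q + 0 * g
      exponents = ≤-trans (m≤m+n _ (5 + t)) (≤-reflexive (e t))
        where
        e : ∀ t → 1 + (t * suc (8 + 4 * t)) + (5 + t) ≡ 1 * (2 * suc t * (3 + 2 * t)) + 0
        e = solve-∀

open TailBounds

-- Codes for 2-regular graphs and their weighted enumeration.

module Codes where
  open import Data.Nat
  open import Data.Nat.Properties
  open import Data.Nat.Tactic.RingSolver using (solve-∀)
  open import Data.Nat.ListAction using (sum)
  open import Data.Nat.ListAction.Properties using (sum-++)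
  open import Data.Fin using (Fin)
  open import Data.Vec using (Vec; []; _∷_; lookup; removeAt)
  open import Data.List using (List; []; _∷_; _++_; map; length; allFin; cartesianProductWith)
  open import Data.List.Properties using (map-++; map-cong; length-map; length-++; length-tabulate)
  open import Data.List.Membership.Propositional using (_∈_)
  open import Data.List.Membership.Propositional.Properties
    using (∈-++⁺ˡ; ∈-++⁺ʳ; ∈-++⁻; ∈-map⁺; ∈-map⁻; ∈-allFin; ∈-cartesianProductWith⁺; ∈-cartesianProductWith⁻; ∈-∃++)
  open import Data.List.Relation.Unary.Any using (here; there)
  open import Data.List.Relation.Unary.All as All using (All; []; _∷_)
  open import Data.List.Relation.Unary.AllPairs using ([]; _∷_)
  open import Data.List.Relation.Unary.Unique.Propositional using (Unique)
  import Data.List.Relation.Unary.Unique.Propositional.Properties as Uniqueₚ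
  open import Data.Product using (_,_; _×_)
  open import Data.Sum using (inj₁; inj₂)
  open import Relation.Binary.PropositionalEquality
  open import Relation.Nullary using (contradiction)

  sum-map-≤ : ∀ {A : Set} (f : A → ℕ) {xs ys : List A} → Unique xs → (∀ {x} → x ∈ xs → x ∈ ys) →
              sum (map f xs) ≤ sum (map f ys)
  sum-map-≤ f {[]}     _          _     = z≤n
  sum-map-≤ f {x ∷ xs} (x∉ ∷ uniq) xs⊆ys with as , bs , refl ← ∈-∃++ (xs⊆ys (here refl)) = begin
    f x + sum (map f xs)                         ≤⟨ +-monoʳ-≤ (f x) (sum-map-≤ f uniq xs⊆) ⟩
    f x + sum (map f (as ++ bs))                 ≡⟨ cong (f x +_) (sum-map-++ as bs) ⟩
    f x + (sum (map f as) + sum (map f bs))      ≡⟨ lem (f x) (sum (map f as)) (sum (map f bs)) ⟩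
    sum (map f as) + (f x + sum (map f bs))      ≡⟨ sum-map-++ as (x ∷ bs) ⟨
    sum (map f (as ++ x ∷ bs))                   ∎
    where
    open ≤-Reasoning
    sum-map-++ : ∀ us vs → sum (map f (us ++ vs)) ≡ sum (map f us) + sum (map f vs)
    sum-map-++ us vs = trans (cong sum (map-++ f us vs)) (sum-++ (map f us) (map f vs))
    lem : ∀ x y z → x + (y + z) ≡ y + (x + z)
    lem = solve-∀
    xs⊆ : ∀ {z} → z ∈ xs → z ∈ as ++ bs
    xs⊆ z∈xs with ∈-++⁻ as (xs⊆ys (there z∈xs))
    ... | inj₁ z∈as         = ∈-++⁺ˡ z∈as
    ... | inj₂ (here refl)  = contradiction refl (All.lookup x∉ z∈xs)
    ... | inj₂ (there z∈bs) = ∈-++⁺ʳ as z∈bs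

  sum-map-const : ∀ {A : Set} k (xs : List A) → sum (map (λ _ → k) xs) ≡ length xs * k
  sum-map-const k []       = refl
  sum-map-const k (x ∷ xs) = cong (k +_) (sum-map-const k xs)

  length-≤ : ∀ {A : Set} {xs ys : List A} → Unique xs → (∀ {x} → x ∈ xs → x ∈ ys) → length xs ≤ length ys
  length-≤ {xs = xs} {ys} uniq xs⊆ys = begin
    length xs                ≡⟨ count xs ⟨
    sum (map (λ _ → 1) xs)   ≤⟨ sum-map-≤ (λ _ → 1) uniq xs⊆ys ⟩
    sum (map (λ _ → 1) ys)   ≡⟨ count ys ⟩
    length ys                ∎
    where
    open ≤-Reasoning
    count : ∀ zs → sum (map (λ _ → 1) zs) ≡ length zs
    count zs = trans (sum-map-const 1 zs) (*-identityʳ (length zs))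

  sum-cartesianProductWith : ∀ {A B C : Set} (f : A → B → C) (h : C → ℕ) (p : A → ℕ) (q : B → ℕ) →
    (∀ x y → h (f x y) ≡ p x * q y) → ∀ xs ys →
    sum (map h (cartesianProductWith f xs ys)) ≡ sum (map p xs) * sum (map q ys)
  sum-cartesianProductWith f h p q hf []       ys = refl
  sum-cartesianProductWith f h p q hf (x ∷ xs) ys = begin
    sum (map h (map (f x) ys ++ rest))
      ≡⟨ cong sum (map-++ h (map (f x) ys) rest) ⟩
    sum (map h (map (f x) ys) ++ map h rest)
      ≡⟨ sum-++ (map h (map (f x) ys)) (map h rest) ⟩
    sum (map h (map (f x) ys)) + sum (map h rest)
      ≡⟨ cong₂ _+_ (row ys) (sum-cartesianProductWith f h p q hf xs ys) ⟩
    p x * sum (map q ys) + sum (map p xs) * sum (map q ys)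
      ≡⟨ *-distribʳ-+ (sum (map q ys)) (p x) (sum (map p xs)) ⟨
    (p x + sum (map p xs)) * sum (map q ys) ∎
    where
    open ≡-Reasoning
    rest = cartesianProductWith f xs ys
    row : ∀ zs → sum (map h (map (f x) zs)) ≡ p x * sum (map q zs)
    row []       = sym (*-zeroʳ (p x))
    row (z ∷ zs) = trans (cong₂ _+_ (hf x z) (row zs)) (sym (*-distribˡ-+ (p x) (q z) (sum (map q zs))))

  -- Unordered pairs of positions in a vector of length m + 2.
  data Pair : ℕ → Set where
    first : ∀ {m} → Fin (suc m) → Pair m
    skip  : ∀ {m} → Pair m → Pair (suc m)

  module _ {A : Set} where
    fstAt sndAt : ∀ {m} → Vec A (2 + m) → Pair m → A
    fstAt (x ∷ xs) (first i) = x
    fstAt (x ∷ xs) (skip p)  = fstAt xs p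
    sndAt (x ∷ xs) (first i) = lookup xs i
    sndAt (x ∷ xs) (skip p)  = sndAt xs p

    removePair : ∀ {m} → Vec A (2 + m) → Pair m → Vec A m
    removePair (x ∷ xs) (first i) = removeAt xs i
    removePair (x ∷ xs) (skip p)  = x ∷ removePair xs p

  pairs : ∀ m → List (Pair m)
  pairs zero    = map first (allFin 1)
  pairs (suc m) = map first (allFin (2 + m)) ++ map skip (pairs m)

  length-pairs : ∀ m → length (pairs m) ≡ pairCount m
  length-pairs zero    = refl
  length-pairs (suc m) = begin
    length (map first (allFin (2 + m)) ++ map skip (pairs m))
      ≡⟨ length-++ (map first (allFin (2 + m))) ⟩
    length (map (first {suc m}) (allFin (2 + m))) + length (map skip (pairs m))
      ≡⟨ cong₂ _+_ (trans (length-map first (allFin (2 + m))) (length-tabulate {n = 2 + m} (λ i → i)))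
                   (trans (length-map skip (pairs m)) (length-pairs m)) ⟩
    2 + m + pairCount m ∎
    where open ≡-Reasoning

  ∈-pairs : ∀ {m} (p : Pair m) → p ∈ pairs m
  ∈-pairs {zero}  (first i) = ∈-map⁺ first (∈-allFin i)
  ∈-pairs {suc m} (first i) = ∈-++⁺ˡ (∈-map⁺ first (∈-allFin i))
  ∈-pairs {suc m} (skip p)  = ∈-++⁺ʳ (map first (allFin (2 + m))) (∈-map⁺ skip (∈-pairs p))

  pairs-unique : ∀ m → Unique (pairs m)
  pairs-unique zero    = [] ∷ []
  pairs-unique (suc m) =
    Uniqueₚ.++⁺ (Uniqueₚ.map⁺ (λ { refl → refl }) (Uniqueₚ.allFin⁺ (2 + m)))
                (Uniqueₚ.map⁺ (λ { refl → refl }) (pairs-unique m)) disjoint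
    where
    disjoint : ∀ {p} → p ∈ map first (allFin (2 + m)) × p ∈ map skip (pairs m) → _
    disjoint (∈₁ , ∈₂) with _ , _ , refl ← ∈-map⁻ first ∈₁ | _ , _ , () ← ∈-map⁻ skip ∈₂

  -- A construction of a 2-regular graph on a vector z ∷ vs of distinct vertices: ins inserts z into
  -- the oriented edge leaving a vertex of vs, tri makes a new triangle of z and a pair from vs.
  data Code : ℕ → Set where
    nil : Code 0
    ins : ∀ {n} → Code n → Fin n → Code (suc n)
    tri : ∀ {m} → Pair m → Code m → Code (3 + m)

  cycles : ∀ {n} → Code n → ℕ
  cycles nil       = 0
  cycles (ins c i) = cycles c
  cycles (tri p c) = suc (cycles c)

  -- An insertion adds one vertex and no cycle, hence the factor b; a triangle adds three vertices
  -- and one cycle, hence a b^2. The product is a^c b^(n-c).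
  weight : ∀ (a b : ℕ) {n} → Code n → ℕ
  weight a b nil       = 1
  weight a b (ins c i) = weight a b c * b
  weight a b (tri p c) = a * (b * b) * weight a b c

  weight-cycles : ∀ a b {n} (c : Code n) → weight a b c * b ^ cycles c ≡ a ^ cycles c * b ^ n
  weight-cycles a b nil           = refl
  weight-cycles a b {suc n} (ins c i) = begin
    weight a b c * b * b ^ cycles c      ≡⟨ e (weight a b c) b (b ^ cycles c) ⟩
    weight a b c * b ^ cycles c * b      ≡⟨ cong (_* b) (weight-cycles a b c) ⟩
    a ^ cycles c * b ^ n * b             ≡⟨ e′ (a ^ cycles c) (b ^ n) b ⟩
    a ^ cycles c * (b * b ^ n)           ∎
    where
    open ≡-Reasoning
    e : ∀ w b x → w * b * x ≡ w * x * b
    e = solve-∀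
    e′ : ∀ x y b → x * y * b ≡ x * (b * y)
    e′ = solve-∀
  weight-cycles a b {suc (suc (suc m))} (tri p c) = begin
    a * (b * b) * weight a b c * (b * b ^ cycles c)      ≡⟨ e a b (weight a b c) (b ^ cycles c) ⟩
    a * (b * b * b) * (weight a b c * b ^ cycles c)      ≡⟨ cong (a * (b * b * b) *_) (weight-cycles a b c) ⟩
    a * (b * b * b) * (a ^ cycles c * b ^ m)             ≡⟨ e′ a b (a ^ cycles c) (b ^ m) ⟩
    a * a ^ cycles c * (b * (b * (b * b ^ m)))           ∎
    where
    open ≡-Reasoning
    e : ∀ a b w x → a * (b * b) * w * (b * x) ≡ a * (b * b * b) * (w * x)
    e = solve-∀
    e′ : ∀ a b x y → a * (b * b * b) * (x * y) ≡ a * x * (b * (b * (b * y)))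
    e′ = solve-∀

  -- There are no codes of size 1 or 2: the first insertion would need an arc of the empty graph,
  -- and a triangle needs three vertices.
  codes : ∀ n → List (Code n)
  codes 0 = nil ∷ []
  codes 1 = []
  codes 2 = []
  codes (suc (suc (suc m))) =
    cartesianProductWith ins (codes (suc (suc m))) (allFin (2 + m)) ++
    cartesianProductWith tri (pairs m) (codes m)

  ∈-codes : ∀ {n} (c : Code n) → c ∈ codes n
  ∈-codes nil = here refl
  ∈-codes {suc (suc (suc m))} (ins c i) = ∈-++⁺ˡ (∈-cartesianProductWith⁺ ins (∈-codes c) (∈-allFin i))
  ∈-codes {suc (suc zero)} (ins (ins c ()) i)
  ∈-codes {suc (suc (suc m))} (tri p c) =
    ∈-++⁺ʳ (cartesianProductWith ins (codes (2 + m)) (allFin (2 + m)))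
      (∈-cartesianProductWith⁺ tri (∈-pairs p) (∈-codes c))

  codes-unique : ∀ n → Unique (codes n)
  codes-unique 0 = [] ∷ []
  codes-unique 1 = []
  codes-unique 2 = []
  codes-unique (suc (suc (suc m))) =
    Uniqueₚ.++⁺
      (Uniqueₚ.cartesianProductWith⁺ ins (λ { refl → refl , refl }) (codes-unique (suc (suc m))) (Uniqueₚ.allFin⁺ (2 + m)))
      (Uniqueₚ.cartesianProductWith⁺ tri (λ { refl → refl , refl }) (pairs-unique m) (codes-unique m))
      disjoint
    where
    disjoint : ∀ {c} → c ∈ cartesianProductWith ins (codes (2 + m)) (allFin (2 + m)) ×
                       c ∈ cartesianProductWith tri (pairs m) (codes m) → _
    disjoint (∈₁ , ∈₂)
      with _ , _ , _ , _ , refl ← ∈-cartesianProductWith⁻ ins (codes (2 + m)) (allFin (2 + m)) ∈₁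
         | _ , _ , _ , _ , () ← ∈-cartesianProductWith⁻ tri (pairs m) (codes m) ∈₂

  -- The recurrence term by term: 2 + m arcs to insert into, and C(m+2,2) pairs to complete the
  -- triangle of the first vertex.
  sum-weights : ∀ a b n → sum (map (weight a b) (codes n)) ≡ cycleWeight a b n
  sum-weights a b 0 = sym (cycleWeight-0 a b)
  sum-weights a b 1 = sym (cycleWeight-1 a b)
  sum-weights a b 2 = sym (cycleWeight-2 a b)
  sum-weights a b (suc (suc (suc m))) = begin
    sum (map w (I ++ T))
      ≡⟨ trans (cong sum (map-++ w I T)) (sum-++ (map w I) (map w T)) ⟩
    sum (map w I) + sum (map w T)
      ≡⟨ cong₂ _+_
           (sum-cartesianProductWith ins w w (λ _ → b) (λ _ _ → refl) (codes (2 + m)) (allFin (2 + m)))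
           (sum-cartesianProductWith tri w (λ _ → a * (b * b)) w (λ _ _ → refl) (pairs m) (codes m)) ⟩
    sum (map w (codes (2 + m))) * sum (map (λ _ → b) (allFin (2 + m))) +
    sum (map (λ _ → a * (b * b)) (pairs m)) * sum (map w (codes m))
      ≡⟨ cong₂ _+_
           (cong₂ _*_ (sum-weights a b (suc (suc m)))
             (trans (sum-map-const b (allFin (2 + m))) (cong (_* b) (length-tabulate {n = 2 + m} (λ i → i)))))
           (cong₂ _*_ (trans (sum-map-const (a * (b * b)) (pairs m)) (cong (_* (a * (b * b))) (length-pairs m)))
             (sum-weights a b m)) ⟩
    W₂ * ((2 + m) * b) + pairCount m * (a * (b * b)) * W₀
      ≡⟨ e W₂ (2 + m) b (pairCount m) (a * (b * b)) W₀ ⟩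
    b * (2 + m) * W₂ + a * (b * b) * pairCount m * W₀
      ≡⟨ cycleWeight-step a b m ⟨
    cycleWeight a b (3 + m) ∎
    where
    open ≡-Reasoning
    w : ∀ {n} → Code n → ℕ
    w = weight a b
    W₂ = cycleWeight a b (2 + m)
    W₀ = cycleWeight a b m
    I = cartesianProductWith ins (codes (2 + m)) (allFin (2 + m))
    T = cartesianProductWith tri (pairs m) (codes m)
    e : ∀ x n b p q y → x * (n * b) + p * q * y ≡ b * n * x + q * p * y
    e = solve-∀

  length-codes : ∀ n → length (codes n) ≡ regularCount n
  length-codes n = begin
    length (codes n)                    ≡⟨ *-identityʳ _ ⟨
    length (codes n) * 1                ≡⟨ sum-map-const 1 (codes n) ⟨
    sum (map (λ _ → 1) (codes n))       ≡⟨ cong sum (map-cong weight-1-1 (codes n)) ⟩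
    sum (map (weight 1 1) (codes n))    ≡⟨ sum-weights 1 1 n ⟩
    regularCount n                      ∎
    where
    open ≡-Reasoning
    weight-1-1 : ∀ {n} (c : Code n) → 1 ≡ weight 1 1 c
    weight-1-1 nil       = refl
    weight-1-1 (ins c i) = trans (weight-1-1 c) (sym (*-identityʳ _))
    weight-1-1 (tri p c) = trans (weight-1-1 c) (sym (*-identityˡ _))

open Codes

-- The oriented edges of the graph built by a code.

module Arcs where
  open import Data.Nat using (zero; suc; _+_)
  open import Data.Fin using (zero; suc)
  open import Data.Vec using (Vec; []; _∷_; lookup; removeAt)
  open import Data.Vec.Membership.Propositional using (_∈_; _∉_)
  open import Data.Vec.Membership.Propositional.Properties using (∈-lookup)
  open import Data.Vec.Relation.Unary.Any as Any using (here; there)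
  import Data.Vec.Relation.Unary.Any.Properties as Anyₚ
  import Data.Vec.Relation.Unary.All as All
  open import Data.Vec.Relation.Unary.All using (All; []; _∷_)
  open import Data.Vec.Relation.Unary.AllPairs using ([]; _∷_)
  open import Data.Vec.Relation.Unary.Unique.Propositional using (Unique)
  open import Data.Vec.Relation.Unary.Unique.Propositional.Properties using (lookup-injective)
  open import Data.Product using (_,_; ∃-syntax; _×_)
  open import Data.Sum using (_⊎_; inj₁; inj₂)
  open import Relation.Binary.PropositionalEquality
  open import Relation.Nullary using (¬_; contradiction)

  SamePair : {V : Set} → V → V → V → V → Set
  SamePair x y a b = (a ≡ x × b ≡ y) ⊎ (a ≡ y × b ≡ x)

  module _ {V : Set} where
    Unique⇒∉ : ∀ {n x} {xs : Vec V n} → Unique (x ∷ xs) → x ∉ xs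
    Unique⇒∉ (x≢ ∷ _) x∈xs = All.lookup x≢ x∈xs refl

    Unique-tail : ∀ {n x} {xs : Vec V n} → Unique (x ∷ xs) → Unique xs
    Unique-tail (_ ∷ u) = u

    ∉⇒Unique : ∀ {n x} {xs : Vec V n} → x ∉ xs → Unique xs → Unique (x ∷ xs)
    ∉⇒Unique x∉xs u = distinct x∉xs ∷ u
      where
      distinct : ∀ {n x} {xs : Vec V n} → x ∉ xs → All (x ≢_) xs
      distinct {xs = []}     _   = []
      distinct {xs = y ∷ ys} x∉ = (λ x≡y → x∉ (here x≡y)) ∷ distinct (λ x∈ → x∉ (there x∈))

    removeAt-⊆ : ∀ {n} (xs : Vec V (suc n)) i {v} → v ∈ removeAt xs i → v ∈ xs
    removeAt-⊆ (x ∷ xs)       zero    v∈         = there v∈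
    removeAt-⊆ (x ∷ xs@(_ ∷ _)) (suc i) (here eq)  = here eq
    removeAt-⊆ (x ∷ xs@(_ ∷ _)) (suc i) (there v∈) = there (removeAt-⊆ xs i v∈)

    removeAt-cover : ∀ {n} (xs : Vec V (suc n)) i {v} → v ∈ xs → v ≡ lookup xs i ⊎ v ∈ removeAt xs i
    removeAt-cover (x ∷ xs)       zero    (here eq)  = inj₁ eq
    removeAt-cover (x ∷ xs)       zero    (there v∈) = inj₂ v∈
    removeAt-cover (x ∷ xs@(_ ∷ _)) (suc i) (here eq)  = inj₂ (here eq)
    removeAt-cover (x ∷ xs@(_ ∷ _)) (suc i) (there v∈) with removeAt-cover xs i v∈
    ... | inj₁ eq = inj₁ eq
    ... | inj₂ v∈′ = inj₂ (there v∈′)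

    lookup∉removeAt : ∀ {n} {xs : Vec V (suc n)} → Unique xs → ∀ i → lookup xs i ∉ removeAt xs i
    lookup∉removeAt {xs = x ∷ xs}       u zero    v∈        = Unique⇒∉ u v∈
    lookup∉removeAt {xs = x ∷ xs@(_ ∷ _)} u (suc i) (here eq) = Unique⇒∉ u (subst (_∈ xs) eq (∈-lookup i xs))
    lookup∉removeAt {xs = x ∷ xs@(_ ∷ _)} u (suc i) (there v∈) = lookup∉removeAt (Unique-tail u) i v∈

    removeAt-unique : ∀ {n} {xs : Vec V (suc n)} → Unique xs → ∀ i → Unique (removeAt xs i)
    removeAt-unique {xs = x ∷ xs}       u zero    = Unique-tail u
    removeAt-unique {xs = x ∷ xs@(_ ∷ _)} u (suc i) =
      ∉⇒Unique (λ x∈ → Unique⇒∉ u (removeAt-⊆ xs i x∈)) (removeAt-unique (Unique-tail u) i)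

    fstAt∈ : ∀ {m} (xs : Vec V (2 + m)) p → fstAt xs p ∈ xs
    fstAt∈ (x ∷ xs) (first i) = here refl
    fstAt∈ (x ∷ xs) (skip p)  = there (fstAt∈ xs p)

    sndAt∈ : ∀ {m} (xs : Vec V (2 + m)) p → sndAt xs p ∈ xs
    sndAt∈ (x ∷ xs) (first i) = there (∈-lookup i xs)
    sndAt∈ (x ∷ xs) (skip p)  = there (sndAt∈ xs p)

    removePair-⊆ : ∀ {m} (xs : Vec V (2 + m)) p {v} → v ∈ removePair xs p → v ∈ xs
    removePair-⊆ (x ∷ xs) (first i) v∈         = there (removeAt-⊆ xs i v∈)
    removePair-⊆ (x ∷ xs) (skip p)  (here eq)  = here eq
    removePair-⊆ (x ∷ xs) (skip p)  (there v∈) = there (removePair-⊆ xs p v∈)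

    removePair-cover : ∀ {m} (xs : Vec V (2 + m)) p {v} → v ∈ xs →
      v ≡ fstAt xs p ⊎ v ≡ sndAt xs p ⊎ v ∈ removePair xs p
    removePair-cover (x ∷ xs) (first i) (here eq)  = inj₁ eq
    removePair-cover (x ∷ xs) (first i) (there v∈) = inj₂ (removeAt-cover xs i v∈)
    removePair-cover (x ∷ xs) (skip p)  (here eq)  = inj₂ (inj₂ (here eq))
    removePair-cover (x ∷ xs) (skip p)  (there v∈) with removePair-cover xs p v∈
    ... | inj₁ eq         = inj₁ eq
    ... | inj₂ (inj₁ eq)  = inj₂ (inj₁ eq)
    ... | inj₂ (inj₂ v∈′) = inj₂ (inj₂ (there v∈′))

    fstAt∉removePair : ∀ {m} {xs : Vec V (2 + m)} → Unique xs → ∀ p → fstAt xs p ∉ removePair xs p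
    fstAt∉removePair {xs = x ∷ xs} u (first i) v∈         = Unique⇒∉ u (removeAt-⊆ xs i v∈)
    fstAt∉removePair {xs = x ∷ xs} u (skip p)  (here eq)  = Unique⇒∉ u (subst (_∈ xs) eq (fstAt∈ xs p))
    fstAt∉removePair {xs = x ∷ xs} u (skip p)  (there v∈) = fstAt∉removePair (Unique-tail u) p v∈

    sndAt∉removePair : ∀ {m} {xs : Vec V (2 + m)} → Unique xs → ∀ p → sndAt xs p ∉ removePair xs p
    sndAt∉removePair {xs = x ∷ xs} u (first i) v∈         = lookup∉removeAt (Unique-tail u) i v∈
    sndAt∉removePair {xs = x ∷ xs} u (skip p)  (here eq)  = Unique⇒∉ u (subst (_∈ xs) eq (sndAt∈ xs p))
    sndAt∉removePair {xs = x ∷ xs} u (skip p)  (there v∈) = sndAt∉removePair (Unique-tail u) p v∈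

    fstAt≢sndAt : ∀ {m} {xs : Vec V (2 + m)} → Unique xs → ∀ p → fstAt xs p ≢ sndAt xs p
    fstAt≢sndAt {xs = x ∷ xs} u (first i) eq = Unique⇒∉ u (subst (_∈ xs) (sym eq) (∈-lookup i xs))
    fstAt≢sndAt {xs = x ∷ xs} u (skip p)  eq = fstAt≢sndAt (Unique-tail u) p eq

    removePair-unique : ∀ {m} {xs : Vec V (2 + m)} → Unique xs → ∀ p → Unique (removePair xs p)
    removePair-unique {xs = x ∷ xs} u (first i) = removeAt-unique (Unique-tail u) i
    removePair-unique {xs = x ∷ xs} u (skip p)  =
      ∉⇒Unique (λ x∈ → Unique⇒∉ u (removePair-⊆ xs p x∈)) (removePair-unique (Unique-tail u) p)

    -- The head of a duplicate-free vector does not recur in its tail; this refutes every case in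
    -- which the positions disagree about the head or the order is swapped.
    pair-injective : ∀ {m} {xs : Vec V (2 + m)} → Unique xs → ∀ p q →
      SamePair (fstAt xs q) (sndAt xs q) (fstAt xs p) (sndAt xs p) → p ≡ q
    pair-injective {xs = x ∷ xs} u (first i) (first j) (inj₁ (_ , eq)) =
      cong first (lookup-injective (Unique-tail u) i j eq)
    pair-injective {xs = x ∷ xs} u (first i) (first j) (inj₂ (eq , _)) =
      contradiction (subst (_∈ xs) (sym eq) (∈-lookup j xs)) (Unique⇒∉ u)
    pair-injective {xs = x ∷ xs} u (first i) (skip q) (inj₁ (eq , _)) =
      contradiction (subst (_∈ xs) (sym eq) (fstAt∈ xs q)) (Unique⇒∉ u)
    pair-injective {xs = x ∷ xs} u (first i) (skip q) (inj₂ (eq , _)) =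
      contradiction (subst (_∈ xs) (sym eq) (sndAt∈ xs q)) (Unique⇒∉ u)
    pair-injective {xs = x ∷ xs} u (skip p) (first j) (inj₁ (eq , _)) =
      contradiction (subst (_∈ xs) eq (fstAt∈ xs p)) (Unique⇒∉ u)
    pair-injective {xs = x ∷ xs} u (skip p) (first j) (inj₂ (_ , eq)) =
      contradiction (subst (_∈ xs) eq (sndAt∈ xs p)) (Unique⇒∉ u)
    pair-injective {xs = x ∷ xs} u (skip p) (skip q) same = cong skip (pair-injective (Unique-tail u) p q same)

    pair-exists : ∀ {m} {xs : Vec V (2 + m)} {a b} → a ∈ xs → b ∈ xs → a ≢ b →
      ∃[ p ] SamePair a b (fstAt xs p) (sndAt xs p)
    pair-exists (here refl) (here refl) a≢b = contradiction refl a≢b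
    pair-exists (here refl) (there b∈) _ =
      first (Any.index b∈) , inj₁ (refl , sym (Anyₚ.lookup-index b∈))
    pair-exists (there a∈) (here refl) _ =
      first (Any.index a∈) , inj₂ (refl , sym (Anyₚ.lookup-index a∈))
    pair-exists {zero} {_ ∷ _ ∷ []} (there (here refl)) (there (here refl)) a≢b = contradiction refl a≢b
    pair-exists {suc m} {_ ∷ xs} (there a∈) (there b∈) a≢b with p , same ← pair-exists {m} {xs} a∈ b∈ a≢b = skip p , same

    -- The cycles built by a code, oriented; ins c i subdivides the arc leaving lookup vs i.
    data Arc : ∀ {n} → Code n → Vec V n → V → V → Set where
      keep : ∀ {n} {c : Code n} {i z vs a b} → a ≢ lookup vs i → Arc c vs a b → Arc (ins c i) (z ∷ vs) a b
      into : ∀ {n} {c : Code n} {i z vs a b} → a ≡ lookup vs i → b ≡ z → Arc (ins c i) (z ∷ vs) a b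
      out  : ∀ {n} {c : Code n} {i z vs a b} → a ≡ z → Arc c vs (lookup vs i) b → Arc (ins c i) (z ∷ vs) a b
      old  : ∀ {m p} {c : Code m} {z vs a b} → Arc c (removePair vs p) a b → Arc (tri p c) (z ∷ vs) a b
      tri₁ : ∀ {m p} {c : Code m} {z vs a b} → a ≡ z → b ≡ fstAt vs p → Arc (tri p c) (z ∷ vs) a b
      tri₂ : ∀ {m p} {c : Code m} {z vs a b} → a ≡ fstAt vs p → b ≡ sndAt vs p → Arc (tri p c) (z ∷ vs) a b
      tri₃ : ∀ {m p} {c : Code m} {z vs a b} → a ≡ sndAt vs p → b ≡ z → Arc (tri p c) (z ∷ vs) a b

    Edge : ∀ {n} → Code n → Vec V n → V → V → Set
    Edge c vs a b = Arc c vs a b ⊎ Arc c vs b a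

    source∈ : ∀ {n} {c : Code n} {vs a b} → Arc c vs a b → a ∈ vs
    source∈ (keep _ e)         = there (source∈ e)
    source∈ {vs = z ∷ vs} (into {i = i} refl _)    = there (∈-lookup i vs)
    source∈ (out refl _)       = here refl
    source∈ {vs = z ∷ vs} (old {p = p} e)          = there (removePair-⊆ vs p (source∈ e))
    source∈ (tri₁ refl _)      = here refl
    source∈ {vs = z ∷ vs} (tri₂ {p = p} refl _)    = there (fstAt∈ vs p)
    source∈ {vs = z ∷ vs} (tri₃ {p = p} refl _)    = there (sndAt∈ vs p)

    target∈ : ∀ {n} {c : Code n} {vs a b} → Arc c vs a b → b ∈ vs
    target∈ (keep _ e)         = there (target∈ e)
    target∈ (into _ refl)      = here refl
    target∈ (out _ e)          = there (target∈ e)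
    target∈ {vs = z ∷ vs} (old {p = p} e)          = there (removePair-⊆ vs p (target∈ e))
    target∈ {vs = z ∷ vs} (tri₁ {p = p} _ refl)    = there (fstAt∈ vs p)
    target∈ {vs = z ∷ vs} (tri₂ {p = p} _ refl)    = there (sndAt∈ vs p)
    target∈ (tri₃ _ refl)      = here refl

    module TriFacts {m z} {vs : Vec V (2 + m)} (u : Unique (z ∷ vs)) (p : Pair m) where
      z∉ : z ∉ removePair vs p
      z∉ z∈ = Unique⇒∉ u (removePair-⊆ vs p z∈)
      x∉ : fstAt vs p ∉ removePair vs p
      x∉ = fstAt∉removePair (Unique-tail u) p
      y∉ : sndAt vs p ∉ removePair vs p
      y∉ = sndAt∉removePair (Unique-tail u) p
      z≢x : z ≢ fstAt vs p
      z≢x eq = Unique⇒∉ u (subst (_∈ vs) (sym eq) (fstAt∈ vs p))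
      z≢y : z ≢ sndAt vs p
      z≢y eq = Unique⇒∉ u (subst (_∈ vs) (sym eq) (sndAt∈ vs p))
      x≢y : fstAt vs p ≢ sndAt vs p
      x≢y = fstAt≢sndAt (Unique-tail u) p
      ws-unique : Unique (removePair vs p)
      ws-unique = removePair-unique (Unique-tail u) p

    module InsFacts {n z} {vs : Vec V n} (u : Unique (z ∷ vs)) where
      z∉ : z ∉ vs
      z∉ = Unique⇒∉ u
      z≢lookup : ∀ i → z ≢ lookup vs i
      z≢lookup i eq = z∉ (subst (_∈ vs) (sym eq) (∈-lookup i vs))

    Arc-functional : ∀ {n} {c : Code n} {vs a b b′} → Unique vs → Arc c vs a b → Arc c vs a b′ → b ≡ b′
    Arc-functional u (keep _ e)  (keep _ e′)  = Arc-functional (Unique-tail u) e e′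
    Arc-functional u (keep ne _)  (into eq _)   = contradiction eq ne
    Arc-functional u (keep _ e)  (out refl _) = contradiction (source∈ e) (InsFacts.z∉ u)
    Arc-functional u (into eq _)  (keep ne _)   = contradiction eq ne
    Arc-functional u (into _ refl) (into _ refl) = refl
    Arc-functional u (into {i = i} eq _)  (out refl _) = contradiction eq (InsFacts.z≢lookup u i)
    Arc-functional u (out refl _) (keep _ e)  = contradiction (source∈ e) (InsFacts.z∉ u)
    Arc-functional u (out refl _) (into {i = i} eq _) = contradiction eq (InsFacts.z≢lookup u i)
    Arc-functional u (out _ e)   (out _ e′)   = Arc-functional (Unique-tail u) e e′
    Arc-functional u (old {p = p} e)  (old e′)      = Arc-functional (TriFacts.ws-unique u p) e e′
    Arc-functional u (old {p = p} e)  (tri₁ refl _) = contradiction (source∈ e) (TriFacts.z∉ u p)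
    Arc-functional u (old {p = p} e)  (tri₂ refl _) = contradiction (source∈ e) (TriFacts.x∉ u p)
    Arc-functional u (old {p = p} e)  (tri₃ refl _) = contradiction (source∈ e) (TriFacts.y∉ u p)
    Arc-functional u (tri₁ {p = p} refl _) (old e)  = contradiction (source∈ e) (TriFacts.z∉ u p)
    Arc-functional u (tri₁ _ refl) (tri₁ _ refl)    = refl
    Arc-functional u (tri₁ {p = p} refl _) (tri₂ eq _) = contradiction eq (TriFacts.z≢x u p)
    Arc-functional u (tri₁ {p = p} refl _) (tri₃ eq _) = contradiction eq (TriFacts.z≢y u p)
    Arc-functional u (tri₂ {p = p} refl _) (old e)  = contradiction (source∈ e) (TriFacts.x∉ u p)
    Arc-functional u (tri₂ {p = p} eq _) (tri₁ refl _) = contradiction eq (TriFacts.z≢x u p)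
    Arc-functional u (tri₂ _ refl) (tri₂ _ refl)    = refl
    Arc-functional u (tri₂ {p = p} refl _) (tri₃ eq _) = contradiction eq (TriFacts.x≢y u p)
    Arc-functional u (tri₃ {p = p} refl _) (old e)  = contradiction (source∈ e) (TriFacts.y∉ u p)
    Arc-functional u (tri₃ {p = p} eq _) (tri₁ refl _) = contradiction eq (TriFacts.z≢y u p)
    Arc-functional u (tri₃ {p = p} refl _) (tri₂ eq _) = contradiction (sym eq) (TriFacts.x≢y u p)
    Arc-functional u (tri₃ _ refl) (tri₃ _ refl)    = refl

    -- The case of interest sets a kept arc against the second half of the subdivided one: both stem
    -- from old arcs with the same target, hence with the source `lookup vs i`, which `keep`
    -- excludes.
    Arc-injective : ∀ {n} {c : Code n} {vs a a′ b} → Unique vs → Arc c vs a b → Arc c vs a′ b → a ≡ a′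
    Arc-injective u (keep _ e)  (keep _ e′)  = Arc-injective (Unique-tail u) e e′
    Arc-injective u (keep _ e)  (into _ refl) = contradiction (target∈ e) (InsFacts.z∉ u)
    Arc-injective u (keep ne e)  (out _ e′)   = contradiction (Arc-injective (Unique-tail u) e e′) ne
    Arc-injective u (into _ refl) (keep _ e) = contradiction (target∈ e) (InsFacts.z∉ u)
    Arc-injective u (into refl _) (into refl _) = refl
    Arc-injective u (into _ refl) (out _ e)  = contradiction (target∈ e) (InsFacts.z∉ u)
    Arc-injective u (out _ e′)  (keep ne e)   = contradiction (Arc-injective (Unique-tail u) e e′) ne
    Arc-injective u (out _ e) (into _ refl)  = contradiction (target∈ e) (InsFacts.z∉ u)
    Arc-injective u (out refl _) (out refl _) = refl
    Arc-injective u (old {p = p} e)  (old e′)      = Arc-injective (TriFacts.ws-unique u p) e e′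
    Arc-injective u (old {p = p} e)  (tri₁ _ refl) = contradiction (target∈ e) (TriFacts.x∉ u p)
    Arc-injective u (old {p = p} e)  (tri₂ _ refl) = contradiction (target∈ e) (TriFacts.y∉ u p)
    Arc-injective u (old {p = p} e)  (tri₃ _ refl) = contradiction (target∈ e) (TriFacts.z∉ u p)
    Arc-injective u (tri₁ {p = p} _ refl) (old e)  = contradiction (target∈ e) (TriFacts.x∉ u p)
    Arc-injective u (tri₁ refl _) (tri₁ refl _)    = refl
    Arc-injective u (tri₁ {p = p} _ refl) (tri₂ _ eq) = contradiction eq (TriFacts.x≢y u p)
    Arc-injective u (tri₁ {p = p} _ eq) (tri₃ _ refl) = contradiction eq (TriFacts.z≢x u p)
    Arc-injective u (tri₂ {p = p} _ refl) (old e)  = contradiction (target∈ e) (TriFacts.y∉ u p)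
    Arc-injective u (tri₂ {p = p} _ refl) (tri₁ _ eq) = contradiction (sym eq) (TriFacts.x≢y u p)
    Arc-injective u (tri₂ refl _) (tri₂ refl _)    = refl
    Arc-injective u (tri₂ {p = p} _ eq) (tri₃ _ refl) = contradiction eq (TriFacts.z≢y u p)
    Arc-injective u (tri₃ {p = p} _ refl) (old e)  = contradiction (target∈ e) (TriFacts.z∉ u p)
    Arc-injective u (tri₃ {p = p} _ refl) (tri₁ _ eq) = contradiction eq (TriFacts.z≢x u p)
    Arc-injective u (tri₃ {p = p} _ refl) (tri₂ _ eq) = contradiction eq (TriFacts.z≢y u p)
    Arc-injective u (tri₃ refl _) (tri₃ refl _)    = refl

    Arc-irreflexive : ∀ {n} {c : Code n} {vs a} → Unique vs → ¬ Arc c vs a a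
    Arc-irreflexive u (keep _ e)    = Arc-irreflexive (Unique-tail u) e
    Arc-irreflexive u (into {i = i} eq refl) = InsFacts.z≢lookup u i eq
    Arc-irreflexive u (out refl e)  = InsFacts.z∉ u (target∈ e)
    Arc-irreflexive u (old {p = p} e)        = Arc-irreflexive (TriFacts.ws-unique u p) e
    Arc-irreflexive u (tri₁ {p = p} refl eq) = TriFacts.z≢x u p eq
    Arc-irreflexive u (tri₂ {p = p} refl eq) = TriFacts.x≢y u p eq
    Arc-irreflexive u (tri₃ {p = p} eq refl) = TriFacts.z≢y u p eq

    -- This rules out cycles of length two, so successor and predecessor are different neighbours.
    -- Going to the new vertex and back would come from a loop at the vertex whose arc is
    -- subdivided.
    Arc-asymmetric : ∀ {n} {c : Code n} {vs a b} → Unique vs → Arc c vs a b → ¬ Arc c vs b a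
    Arc-asymmetric u (keep _ e)    (keep _ e′)   = Arc-asymmetric (Unique-tail u) e e′
    Arc-asymmetric u (keep _ e)    (into _ refl) = InsFacts.z∉ u (source∈ e)
    Arc-asymmetric u (keep _ e)    (out refl _)  = InsFacts.z∉ u (target∈ e)
    Arc-asymmetric u (into _ refl) (keep _ e)    = InsFacts.z∉ u (source∈ e)
    Arc-asymmetric u (into _ refl) (into {i = i} eq _)   = InsFacts.z≢lookup u i eq
    Arc-asymmetric u (into refl _) (out _ e)     = Arc-irreflexive (Unique-tail u) e
    Arc-asymmetric u (out refl _)  (keep _ e)    = InsFacts.z∉ u (target∈ e)
    Arc-asymmetric u (out _ e)     (into refl _) = Arc-irreflexive (Unique-tail u) e
    Arc-asymmetric u (out _ e)     (out refl _)  = InsFacts.z∉ u (target∈ e)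
    Arc-asymmetric u (old {p = p} e)  (old e′)      = Arc-asymmetric (TriFacts.ws-unique u p) e e′
    Arc-asymmetric u (old {p = p} e)  (tri₁ refl _) = TriFacts.z∉ u p (target∈ e)
    Arc-asymmetric u (old {p = p} e)  (tri₂ refl _) = TriFacts.x∉ u p (target∈ e)
    Arc-asymmetric u (old {p = p} e)  (tri₃ refl _) = TriFacts.y∉ u p (target∈ e)
    Arc-asymmetric u (tri₁ {p = p} refl _) (old e)       = TriFacts.z∉ u p (target∈ e)
    Arc-asymmetric u (tri₁ {p = p} refl _) (tri₁ _ eq)   = TriFacts.z≢x u p eq
    Arc-asymmetric u (tri₁ {p = p} refl _) (tri₂ _ eq)   = TriFacts.z≢y u p eq
    Arc-asymmetric u (tri₁ {p = p} _ refl) (tri₃ eq _)   = TriFacts.x≢y u p eq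
    Arc-asymmetric u (tri₂ {p = p} refl _) (old e)       = TriFacts.x∉ u p (target∈ e)
    Arc-asymmetric u (tri₂ {p = p} _ eq)   (tri₁ refl _) = TriFacts.z≢y u p eq
    Arc-asymmetric u (tri₂ {p = p} refl _) (tri₂ _ eq)   = TriFacts.x≢y u p eq
    Arc-asymmetric u (tri₂ {p = p} eq _)   (tri₃ _ refl) = TriFacts.z≢x u p eq
    Arc-asymmetric u (tri₃ {p = p} refl _) (old e)       = TriFacts.y∉ u p (target∈ e)
    Arc-asymmetric u (tri₃ {p = p} refl _) (tri₁ _ eq)   = TriFacts.x≢y u p (sym eq)
    Arc-asymmetric u (tri₃ {p = p} _ refl) (tri₂ eq _)   = TriFacts.z≢x u p eq
    Arc-asymmetric u (tri₃ {p = p} _ refl) (tri₃ eq _)   = TriFacts.z≢y u p eq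

open Arcs

-- Regularity of the coded graph, and one representative for each cycle.

module CycleClasses where
  open import Data.Nat using (suc)
  open import Data.List using (List; []; _∷_; length)
  open import Data.List.Membership.Propositional using () renaming (_∈_ to _∈ˡ_)
  open import Data.List.Relation.Unary.Any using () renaming (here to hereˡ; there to thereˡ)
  import Data.List.Relation.Unary.All as Allˡ
  open import Data.List.Relation.Unary.AllPairs using ([]; _∷_)
  open import Data.List.Relation.Unary.Unique.Propositional using () renaming (Unique to Uniqueˡ)
  open import Data.Vec using (Vec; []; _∷_; lookup)
  open import Data.Vec.Membership.Propositional using (_∈_)
  open import Data.Vec.Membership.Propositional.Properties using (∈-lookup)
  open import Data.Vec.Relation.Unary.Any using (here; there)
  open import Data.Vec.Relation.Unary.Unique.Propositional using (Unique)
  open import Data.Product using (_,_; ∃-syntax; _×_)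
  open import Data.Sum using (_⊎_; inj₁; inj₂; swap)
  open import Function using (_∘_)
  open import Relation.Binary using (DecidableEquality)
  open import Relation.Binary.Construct.Closure.ReflexiveTransitive using (Star; ε; _◅_; _◅◅_; _⋆)
  open import Relation.Binary.PropositionalEquality
  open import Relation.Nullary using (¬_; yes; no; contradiction)

  -- A relation on a fixed type together with a vertex vector, rather than a matrix: deleting
  -- vertices then only shortens the vector. Degree two is given by two distinct neighbours that
  -- exhaust all of them.
  record TwoRegular {V : Set} (R : V → V → Set) {n} (vs : Vec V n) : Set where
    field
      symmetric   : ∀ {a b} → R a b → R b a
      irreflexive : ∀ {a} → ¬ R a a
      support     : ∀ {a b} → R a b → a ∈ vs
      neighbours  : ∀ {a} → a ∈ vs → ∃[ u ] ∃[ w ] (u ≢ w × R a u × R a w × (∀ {b} → R a b → b ≡ u ⊎ b ≡ w))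

    neighbour-of : ∀ {a u w} → u ≢ w → R a u → R a w → ∀ {b} → R a b → b ≡ u ⊎ b ≡ w
    neighbour-of {a} u≢w Rau Raw Rab with p , q , _ , _ , _ , only ← neighbours (support Rau)
      with only Rau | only Raw | only Rab
    ... | inj₁ refl | inj₁ refl | _         = contradiction refl u≢w
    ... | inj₁ refl | inj₂ refl | b         = b
    ... | inj₂ refl | inj₁ refl | b         = swap b
    ... | inj₂ refl | inj₂ refl | _         = contradiction refl u≢w

    other-neighbour : ∀ {a z} → R a z → ∃[ b ] (b ≢ z × R a b × (∀ {c} → R a c → c ≡ z ⊎ c ≡ b))
    other-neighbour Raz with p , q , p≢q , Rap , Raq , only ← neighbours (support Raz) with only Raz
    ... | inj₁ refl = q , p≢q ∘ sym , Raq , only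
    ... | inj₂ refl = p , p≢q , Rap , swap ∘ only

  module _ {V : Set} (_≟_ : DecidableEquality V) where

    -- Decidable equality tells whether the arc leaving `a` is the one that has been subdivided.
    Arc-next : ∀ {n} (c : Code n) {vs : Vec V n} {a} → a ∈ vs → ∃[ b ] Arc c vs a b
    Arc-next (ins c i) {z ∷ vs} (here refl) with b , e ← Arc-next c (∈-lookup i vs) = b , out refl e
    Arc-next (ins c i) {z ∷ vs} {a} (there a∈) with a ≟ lookup vs i
    ... | yes eq = z , into eq refl
    ... | no ne with b , e ← Arc-next c a∈ = b , keep ne e
    Arc-next (tri p c) {z ∷ vs} (here refl) = fstAt vs p , tri₁ refl refl
    Arc-next (tri p c) {z ∷ vs} (there a∈) with removePair-cover vs p a∈
    ... | inj₁ eq        = sndAt vs p , tri₂ eq refl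
    ... | inj₂ (inj₁ eq) = z , tri₃ eq refl
    ... | inj₂ (inj₂ a∈′) with b , e ← Arc-next c a∈′ = b , old e

    Arc-prev : ∀ {n} (c : Code n) {vs : Vec V n} {b} → b ∈ vs → ∃[ a ] Arc c vs a b
    Arc-prev (ins c i) {z ∷ vs} (here refl) = lookup vs i , into refl refl
    Arc-prev (ins c i) {z ∷ vs} (there b∈) with Arc-prev c b∈
    ... | a , e with a ≟ lookup vs i
    ...   | yes refl = z , out refl e
    ...   | no ne    = a , keep ne e
    Arc-prev (tri p c) {z ∷ vs} (here refl) = sndAt vs p , tri₃ refl refl
    Arc-prev (tri p c) {z ∷ vs} (there b∈) with removePair-cover vs p b∈
    ... | inj₁ eq        = z , tri₁ refl eq
    ... | inj₂ (inj₁ eq) = fstAt vs p , tri₂ refl eq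
    ... | inj₂ (inj₂ b∈′) with a , e ← Arc-prev c b∈′ = a , old e

    Edge-regular : ∀ {n} (c : Code n) {vs : Vec V n} → Unique vs → TwoRegular (Edge c vs) vs
    Edge-regular c u = record
      { symmetric   = swap
      ; irreflexive = λ { (inj₁ e) → Arc-irreflexive u e ; (inj₂ e) → Arc-irreflexive u e }
      ; support     = λ { (inj₁ e) → source∈ e ; (inj₂ e) → target∈ e }
      ; neighbours  = λ a∈ → let (s , as) = Arc-next c a∈ ; (r , ra) = Arc-prev c a∈ in
          s , r , (λ s≡r → Arc-asymmetric u as (subst (λ x → Arc c _ x _) (sym s≡r) ra)) , inj₁ as , inj₂ ra ,
          λ { (inj₁ e) → inj₁ (Arc-functional u e as) ; (inj₂ e) → inj₂ (Arc-injective u e ra) }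
      }

    -- Every cycle begins as a triangle and is represented by the vertex `z` of that `tri`;
    -- insertions neither create nor merge cycles.
    representatives : ∀ {n} → Code n → Vec V n → List V
    representatives nil       []       = []
    representatives (ins c i) (z ∷ vs) = representatives c vs
    representatives (tri p c) (z ∷ vs) = z ∷ representatives c (removePair vs p)

    length-representatives : ∀ {n} (c : Code n) vs → length (representatives c vs) ≡ cycles c
    length-representatives nil       []       = refl
    length-representatives (ins c i) (z ∷ vs) = length-representatives c vs
    length-representatives (tri p c) (z ∷ vs) = cong suc (length-representatives c (removePair vs p))

    representatives⊆ : ∀ {n} (c : Code n) vs {r} → r ∈ˡ representatives c vs → r ∈ vs
    representatives⊆ nil       []       ()
    representatives⊆ (ins c i) (z ∷ vs) r∈           = there (representatives⊆ c vs r∈)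
    representatives⊆ (tri p c) (z ∷ vs) (hereˡ eq)   = here eq
    representatives⊆ (tri p c) (z ∷ vs) (thereˡ r∈)  =
      there (removePair-⊆ vs p (representatives⊆ c (removePair vs p) r∈))

    representatives-unique : ∀ {n} (c : Code n) {vs} → Unique vs → Uniqueˡ (representatives c vs)
    representatives-unique nil       {[]}     u = []
    representatives-unique (ins c i) {z ∷ vs} u = representatives-unique c (Unique-tail u)
    representatives-unique (tri p c) {z ∷ vs} u =
      Allˡ.tabulate (λ { r∈ refl → TriFacts.z∉ u p (representatives⊆ c _ r∈) }) ∷
      representatives-unique c (TriFacts.ws-unique u p)

    representative : ∀ {n} → Code n → Vec V n → V → V
    representative nil       []       v = v
    representative (ins c i) (z ∷ vs) v with v ≟ z
    ... | yes _ = representative c vs (lookup vs i)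
    ... | no  _ = representative c vs v
    representative (tri p c) (z ∷ vs) v with v ≟ z | v ≟ fstAt vs p | v ≟ sndAt vs p
    ... | yes _ | _     | _     = z
    ... | no  _ | yes _ | _     = z
    ... | no  _ | no _  | yes _ = z
    ... | no  _ | no _  | no _  = representative c (removePair vs p) v

    representative-new : ∀ {n} (c : Code n) i z vs → representative (ins c i) (z ∷ vs) z ≡ representative c vs (lookup vs i)
    representative-new c i z vs with z ≟ z
    ... | yes _ = refl
    ... | no ne = contradiction refl ne

    representative-kept : ∀ {n} (c : Code n) i {z vs v} → Unique (z ∷ vs) → v ∈ vs →
      representative (ins c i) (z ∷ vs) v ≡ representative c vs v
    representative-kept c i {z} {v = v} u v∈ with v ≟ z
    ... | yes refl = contradiction v∈ (Unique⇒∉ u)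
    ... | no _     = refl

    representative-tri : ∀ {m} (p : Pair m) (c : Code m) {z vs v} →
      v ≡ z ⊎ v ≡ fstAt vs p ⊎ v ≡ sndAt vs p → representative (tri p c) (z ∷ vs) v ≡ z
    representative-tri p c {z} {vs} {v} eq with v ≟ z | v ≟ fstAt vs p | v ≟ sndAt vs p
    ... | yes _ | _     | _     = refl
    ... | no  _ | yes _ | _     = refl
    ... | no  _ | no _  | yes _ = refl
    ... | no  a | no b  | no d  = contradiction eq λ { (inj₁ e) → a e ; (inj₂ (inj₁ e)) → b e ; (inj₂ (inj₂ e)) → d e }

    representative-old : ∀ {m} (p : Pair m) (c : Code m) {z vs v} → Unique (z ∷ vs) → v ∈ removePair vs p →
      representative (tri p c) (z ∷ vs) v ≡ representative c (removePair vs p) v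
    representative-old p c {z} {vs} {v} u v∈ with v ≟ z | v ≟ fstAt vs p | v ≟ sndAt vs p
    ... | yes refl | _     | _     = contradiction v∈ (TriFacts.z∉ u p)
    ... | no  _ | yes refl | _     = contradiction v∈ (TriFacts.x∉ u p)
    ... | no  _ | no _  | yes refl = contradiction v∈ (TriFacts.y∉ u p)
    ... | no  _ | no _  | no _  = refl

    representative-fixed : ∀ {n} (c : Code n) {vs r} → Unique vs → r ∈ˡ representatives c vs → representative c vs r ≡ r
    representative-fixed nil {[]} u ()
    representative-fixed (ins c i) {z ∷ vs} u r∈ =
      trans (representative-kept c i u (representatives⊆ c vs r∈)) (representative-fixed c (Unique-tail u) r∈)
    representative-fixed (tri p c) {z ∷ vs} u (hereˡ refl) = representative-tri p c (inj₁ refl)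
    representative-fixed (tri p c) {z ∷ vs} u (thereˡ r∈) =
      trans (representative-old p c u (representatives⊆ c _ r∈)) (representative-fixed c (TriFacts.ws-unique u p) r∈)

    -- Together with `reachable` and `representative-fixed`, this identifies the fibres of
    -- `representative` with the cycles.
    representative-arc : ∀ {n} {c : Code n} {vs a b} → Unique vs → Arc c vs a b → representative c vs a ≡ representative c vs b
    representative-arc {c = ins c i} u (keep _ e) =
      trans (representative-kept c i u (source∈ e))
        (trans (representative-arc (Unique-tail u) e) (sym (representative-kept c i u (target∈ e))))
    representative-arc {c = ins c i} {z ∷ vs} u (into refl refl) =
      trans (representative-kept c i u (∈-lookup i vs)) (sym (representative-new c i z vs))
    representative-arc {c = ins c i} {z ∷ vs} u (out refl e) =
      trans (representative-new c i z vs)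
        (trans (representative-arc (Unique-tail u) e) (sym (representative-kept c i u (target∈ e))))
    representative-arc {c = tri p c} u (old e) =
      trans (representative-old p c u (source∈ e))
        (trans (representative-arc (TriFacts.ws-unique u p) e) (sym (representative-old p c u (target∈ e))))
    representative-arc {c = tri p c} u (tri₁ a b) =
      trans (representative-tri p c (inj₁ a)) (sym (representative-tri p c (inj₂ (inj₁ b))))
    representative-arc {c = tri p c} u (tri₂ a b) =
      trans (representative-tri p c (inj₂ (inj₁ a))) (sym (representative-tri p c (inj₂ (inj₂ b))))
    representative-arc {c = tri p c} u (tri₃ a b) =
      trans (representative-tri p c (inj₂ (inj₂ a))) (sym (representative-tri p c (inj₁ b)))

    arc-through : ∀ {n} {c : Code n} {i z vs a b} → Arc c vs a b → Star (Arc (ins c i) (z ∷ vs)) a b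
    arc-through {i = i} {vs = vs} {a} e with a ≟ lookup vs i
    ... | yes refl = into refl refl ◅ out refl e ◅ ε
    ... | no ne    = keep ne e ◅ ε

    -- A path in the smaller graph remains one after its subdivided arc is replaced by the two
    -- halves; an inserted vertex lies one step further.
    reachable : ∀ {n} (c : Code n) {vs v} → v ∈ vs → ∃[ r ] (r ∈ˡ representatives c vs × Star (Arc c vs) r v)
    reachable (ins c i) {z ∷ vs} (here refl) with r , r∈ , path ← reachable c (∈-lookup i vs) =
      r , r∈ , (arc-through ⋆) path ◅◅ into refl refl ◅ ε
    reachable (ins c i) {z ∷ vs} (there v∈) with r , r∈ , path ← reachable c v∈ = r , r∈ , (arc-through ⋆) path
    reachable (tri p c) {z ∷ vs} (here refl) = z , hereˡ refl , ε
    reachable (tri p c) {z ∷ vs} (there v∈) with removePair-cover vs p v∈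
    ... | inj₁ eq        = z , hereˡ refl , tri₁ refl eq ◅ ε
    ... | inj₂ (inj₁ eq) = z , hereˡ refl , tri₁ refl refl ◅ tri₂ refl eq ◅ ε
    ... | inj₂ (inj₂ v∈′) with r , r∈ , path ← reachable c v∈′ =
      r , thereˡ r∈ , ((λ e → old e ◅ ε) ⋆) path

open CycleClasses

-- A graph determines its code.

module CodeInjectivity where
  open import Data.Nat using (_+_)
  open import Data.Fin using (Fin)
  open import Data.Vec using (Vec; _∷_; lookup)
  open import Data.Vec.Membership.Propositional using (_∈_)
  open import Data.Vec.Membership.Propositional.Properties using (∈-lookup)
  open import Data.Vec.Relation.Unary.Unique.Propositional using (Unique)
  open import Data.Vec.Relation.Unary.Unique.Propositional.Properties using (lookup-injective)
  open import Data.Product using (_,_; _×_; proj₁; proj₂)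
  open import Data.Sum as Sum using (_⊎_; inj₁; inj₂)
  open import Data.Empty using (⊥-elim)
  open import Relation.Binary using (DecidableEquality)
  open import Relation.Binary.PropositionalEquality
  open import Relation.Nullary using (¬_; yes; no; contradiction)

  SamePair-swap : ∀ {V : Set} {x y a b : V} → SamePair x y a b → SamePair x y b a
  SamePair-swap (inj₁ (p , q)) = inj₂ (q , p)
  SamePair-swap (inj₂ (p , q)) = inj₁ (q , p)

  SamePair-from-⊆ : ∀ {V : Set} {x y a b : V} → a ≢ b → a ≡ x ⊎ a ≡ y → b ≡ x ⊎ b ≡ y → SamePair x y a b
  SamePair-from-⊆ a≢b (inj₁ p) (inj₁ q) = contradiction (trans p (sym q)) a≢b
  SamePair-from-⊆ a≢b (inj₁ p) (inj₂ q) = inj₁ (p , q)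
  SamePair-from-⊆ a≢b (inj₂ p) (inj₁ q) = inj₂ (p , q)
  SamePair-from-⊆ a≢b (inj₂ p) (inj₂ q) = contradiction (trans p (sym q)) a≢b

  module _ {V : Set} (_≟_ : DecidableEquality V) where
    module _ {n} {c : Code n} {i z} {vs : Vec V n} (u : Unique (z ∷ vs)) {w} (uw : Arc c vs (lookup vs i) w) where
      new-neighbours : ∀ {b} → Edge (ins c i) (z ∷ vs) z b → b ≡ lookup vs i ⊎ b ≡ w
      new-neighbours (inj₁ (keep _ e))   = contradiction (source∈ e) (InsFacts.z∉ u)
      new-neighbours (inj₁ (into eq _))  = contradiction eq (InsFacts.z≢lookup u i)
      new-neighbours (inj₁ (out _ e))    = inj₂ (Arc-functional (Unique-tail u) e uw)
      new-neighbours (inj₂ (keep _ e))   = contradiction (target∈ e) (InsFacts.z∉ u)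
      new-neighbours (inj₂ (into eq _))  = inj₁ eq
      new-neighbours (inj₂ (out refl e)) = contradiction (target∈ e) (InsFacts.z∉ u)

      arc-survives : ∀ {a b} → Arc c vs a b → Arc (ins c i) (z ∷ vs) a b ⊎ SamePair (lookup vs i) w a b
      arc-survives {a} e with a ≟ lookup vs i
      ... | yes refl = inj₂ (inj₁ (refl , Arc-functional (Unique-tail u) e uw))
      ... | no ne    = inj₁ (keep ne e)

      edge-survives : ∀ {a b} → Edge c vs a b → Edge (ins c i) (z ∷ vs) a b ⊎ SamePair (lookup vs i) w a b
      edge-survives (inj₁ e) = Sum.map inj₁ (λ s → s) (arc-survives e)
      edge-survives (inj₂ e) = Sum.map inj₂ SamePair-swap (arc-survives e)

      -- This is what tells an insertion from a triangle, where the two neighbours of `z` are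
      -- adjacent.
      subdivided-arc : ¬ Edge (ins c i) (z ∷ vs) (lookup vs i) w
      subdivided-arc (inj₁ (keep ne _))  = ne refl
      subdivided-arc (inj₁ (into _ refl)) = InsFacts.z∉ u (target∈ uw)
      subdivided-arc (inj₁ (out eq _))   = InsFacts.z≢lookup u i (sym eq)
      subdivided-arc (inj₂ (keep _ e))   = Arc-asymmetric (Unique-tail u) uw e
      subdivided-arc (inj₂ (into _ eq))  = InsFacts.z≢lookup u i (sym eq)
      subdivided-arc (inj₂ (out refl _)) = InsFacts.z∉ u (target∈ uw)

    edge-restrict : ∀ {n} {c : Code n} {i z} {vs : Vec V n} {a b} → a ∈ vs → b ∈ vs → Unique (z ∷ vs) →
      Edge (ins c i) (z ∷ vs) a b → Edge c vs a b
    edge-restrict a∈ b∈ u (inj₁ (keep _ e))    = inj₁ e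
    edge-restrict a∈ b∈ u (inj₁ (into _ refl)) = contradiction b∈ (InsFacts.z∉ u)
    edge-restrict a∈ b∈ u (inj₁ (out refl _))  = contradiction a∈ (InsFacts.z∉ u)
    edge-restrict a∈ b∈ u (inj₂ (keep _ e))    = inj₂ e
    edge-restrict a∈ b∈ u (inj₂ (into _ refl)) = contradiction a∈ (InsFacts.z∉ u)
    edge-restrict a∈ b∈ u (inj₂ (out refl _))  = contradiction b∈ (InsFacts.z∉ u)

    triangle-neighbours : ∀ {m} {p : Pair m} {c : Code m} {z} {vs : Vec V (2 + m)} {b} → Unique (z ∷ vs) →
      Edge (tri p c) (z ∷ vs) z b → b ≡ fstAt vs p ⊎ b ≡ sndAt vs p
    triangle-neighbours {p = p} u (inj₁ (old e))       = contradiction (source∈ e) (TriFacts.z∉ u p)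
    triangle-neighbours         u (inj₁ (tri₁ _ eq))   = inj₁ eq
    triangle-neighbours {p = p} u (inj₁ (tri₂ eq _))   = contradiction eq (TriFacts.z≢x u p)
    triangle-neighbours {p = p} u (inj₁ (tri₃ eq _))   = contradiction eq (TriFacts.z≢y u p)
    triangle-neighbours {p = p} u (inj₂ (old e))       = contradiction (target∈ e) (TriFacts.z∉ u p)
    triangle-neighbours {p = p} u (inj₂ (tri₁ refl eq)) = contradiction eq (TriFacts.z≢x u p)
    triangle-neighbours {p = p} u (inj₂ (tri₂ _ eq))   = contradiction eq (TriFacts.z≢y u p)
    triangle-neighbours         u (inj₂ (tri₃ eq _))   = inj₂ eq

    old-arc : ∀ {m} {p : Pair m} {c : Code m} {z} {vs : Vec V (2 + m)} {a b} → Unique (z ∷ vs) → a ∈ removePair vs p →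
      Arc (tri p c) (z ∷ vs) a b → Arc c (removePair vs p) a b
    old-arc         u a∈ (old e)       = e
    old-arc {p = p} u a∈ (tri₁ refl _) = contradiction a∈ (TriFacts.z∉ u p)
    old-arc {p = p} u a∈ (tri₂ refl _) = contradiction a∈ (TriFacts.x∉ u p)
    old-arc {p = p} u a∈ (tri₃ refl _) = contradiction a∈ (TriFacts.y∉ u p)

    old-edge : ∀ {m} {p : Pair m} {c : Code m} {z} {vs : Vec V (2 + m)} {a b} → Unique (z ∷ vs) →
      a ∈ removePair vs p → b ∈ removePair vs p →
      Edge (tri p c) (z ∷ vs) a b → Edge c (removePair vs p) a b
    old-edge u a∈ b∈ = Sum.map (old-arc u a∈) (old-arc u b∈)

    private
      _⊑_ : (V → V → Set) → (V → V → Set) → Set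
      R ⊑ S = ∀ {a b} → R a b → S a b

    edge∈ : ∀ {n} {c : Code n} {vs : Vec V n} {a b} → Edge c vs a b → a ∈ vs × b ∈ vs
    edge∈ (inj₁ e) = source∈ e , target∈ e
    edge∈ (inj₂ e) = target∈ e , source∈ e

    module _ {n z} {vs : Vec V n} (u : Unique (z ∷ vs)) (c c′ : Code n) (i i′ : Fin n)
             (sub : Edge (ins c i) (z ∷ vs) ⊑ Edge (ins c′ i′) (z ∷ vs)) where
      private
        w = proj₁ (Arc-next _≟_ c (∈-lookup i vs))
        uw = proj₂ (Arc-next _≟_ c (∈-lookup i vs))
        w′ = proj₁ (Arc-next _≟_ c′ (∈-lookup i′ vs))
        uw′ = proj₂ (Arc-next _≟_ c′ (∈-lookup i′ vs))

      -- Each pair is the neighbourhood of `z` in its graph. They agree only up to order, since the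
      -- two codes may still orient the edge differently.
      subdivided-same : SamePair (lookup vs i′) w′ (lookup vs i) w
      subdivided-same = SamePair-from-⊆
        (λ eq → Arc-irreflexive (Unique-tail u) (subst (Arc c vs (lookup vs i)) (sym eq) uw))
        (new-neighbours u uw′ (sub (inj₂ (into refl refl))))
        (new-neighbours u uw′ (sub (inj₁ (out refl uw))))

      -- Every edge of `c` survives the insertion except the subdivided one, and that one is also
      -- the edge subdivided in `c′`.
      ins-reflects-⊑ : Edge c vs ⊑ Edge c′ vs
      ins-reflects-⊑ e with edge-survives u uw e
      ... | inj₁ e′ = edge-restrict (proj₁ (edge∈ e)) (proj₂ (edge∈ e)) u (sub e′)
      ... | inj₂ (inj₁ (refl , refl)) = on-pair subdivided-same
        where
        on-pair : ∀ {a b} → SamePair (lookup vs i′) w′ a b → Edge c′ vs a b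
        on-pair (inj₁ (refl , refl)) = inj₁ uw′
        on-pair (inj₂ (refl , refl)) = inj₂ uw′
      ... | inj₂ (inj₂ (refl , refl)) = on-pair subdivided-same
        where
        on-pair : ∀ {a b} → SamePair (lookup vs i′) w′ a b → Edge c′ vs b a
        on-pair (inj₁ (refl , refl)) = inj₂ uw′
        on-pair (inj₂ (refl , refl)) = inj₁ uw′

    -- Both positions now refer to one orientation, and the common subdivided edge is not an arc in
    -- both directions.
    subdivision-determined : ∀ {n z} {vs : Vec V n} (u : Unique (z ∷ vs)) (c : Code n) (i i′ : Fin n) →
      Edge (ins c i) (z ∷ vs) ⊑ Edge (ins c i′) (z ∷ vs) → i ≡ i′
    subdivision-determined {vs = vs} u c i i′ sub with subdivided-same u c c i i′ sub
    ... | inj₁ (eq , _)  = lookup-injective (Unique-tail u) i i′ eq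
    ... | inj₂ (eq , eq′) = contradiction (proj₂ (Arc-next _≟_ c (∈-lookup i′ vs)))
      (Arc-asymmetric (Unique-tail u) (subst₂ (Arc c vs) eq eq′ (proj₂ (Arc-next _≟_ c (∈-lookup i vs)))))

    ins≢tri : ∀ {m z} {vs : Vec V (2 + m)} → Unique (z ∷ vs) → ∀ {c : Code (2 + m)} {i p} {c′ : Code m} →
      Edge (ins c i) (z ∷ vs) ⊑ Edge (tri p c′) (z ∷ vs) → ¬ (Edge (tri p c′) (z ∷ vs) ⊑ Edge (ins c i) (z ∷ vs))
    ins≢tri {vs = vs} u {c} {i} {p} {c′} sub sup with w , uw ← Arc-next _≟_ c (∈-lookup i vs) =
      subdivided-arc u uw (sup (adjacent (SamePair-from-⊆
        (λ eq → Arc-irreflexive (Unique-tail u) (subst (Arc c vs (lookup vs i)) (sym eq) uw))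
        (triangle-neighbours u (sub (inj₂ (into refl refl))))
        (triangle-neighbours u (sub (inj₁ (out refl uw)))))))
      where
      adjacent : ∀ {z a b} → SamePair (fstAt vs p) (sndAt vs p) a b → Edge (tri p c′) (z ∷ vs) a b
      adjacent (inj₁ (eq , eq′)) = inj₁ (tri₂ eq eq′)
      adjacent (inj₂ (eq , eq′)) = inj₂ (tri₂ eq′ eq)

    triangle-determined : ∀ {m z} {vs : Vec V (2 + m)} → Unique (z ∷ vs) → ∀ {p p′} {c c′ : Code m} →
      Edge (tri p c) (z ∷ vs) ⊑ Edge (tri p′ c′) (z ∷ vs) → p ≡ p′
    triangle-determined u {p} {p′} sub = pair-injective (Unique-tail u) p p′ (SamePair-from-⊆ (TriFacts.x≢y u p)
      (triangle-neighbours u (sub (inj₁ (tri₁ refl refl))))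
      (triangle-neighbours u (sub (inj₂ (tri₃ refl refl)))))

    tri-reflects-⊑ : ∀ {m z} {vs : Vec V (2 + m)} → Unique (z ∷ vs) → ∀ {p} {c c′ : Code m} →
      Edge (tri p c) (z ∷ vs) ⊑ Edge (tri p c′) (z ∷ vs) → Edge c (removePair vs p) ⊑ Edge c′ (removePair vs p)
    tri-reflects-⊑ u sub e = old-edge u (proj₁ (edge∈ e)) (proj₂ (edge∈ e)) (sub (Sum.map old old e))

    code-injective : ∀ {n} {vs : Vec V n} → Unique vs → (c c′ : Code n) →
      Edge c vs ⊑ Edge c′ vs → Edge c′ vs ⊑ Edge c vs → c ≡ c′
    code-injective u nil nil _ _ = refl
    code-injective {vs = z ∷ vs} u (ins c i) (ins c′ i′) sub sup
      -- The smaller codes are identified before the positions, because a position names an arc only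
      -- relative to the orientation given by the code.
      with refl ← code-injective (Unique-tail u) c c′ (ins-reflects-⊑ u c c′ i i′ sub) (ins-reflects-⊑ u c′ c i′ i sup)
      = cong (ins c) (subdivision-determined u c i i′ sub)
    code-injective {vs = z ∷ vs} u (ins c i) (tri p c′) sub sup = ⊥-elim (ins≢tri u sub sup)
    code-injective {vs = z ∷ vs} u (tri p c) (ins c′ i) sub sup = ⊥-elim (ins≢tri u sup sub)
    code-injective {vs = z ∷ vs} u (tri p c) (tri p′ c′) sub sup with refl ← triangle-determined u sub =
      cong (tri p) (code-injective (TriFacts.ws-unique u p) c c′ (tri-reflects-⊑ u sub) (tri-reflects-⊑ u sup))

open CodeInjectivity

-- Every 2-regular graph has a code.

module CodeSurjectivity where
  open import Data.Nat using (zero; suc; _+_)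
  open import Data.Vec using (Vec; []; _∷_; lookup)
  open import Data.Vec.Membership.Propositional using (_∈_)
  open import Data.Vec.Relation.Unary.Any as Any using (here; there)
  import Data.Vec.Relation.Unary.Any.Properties as Anyₚ
  open import Data.Vec.Relation.Unary.Unique.Propositional using (Unique)
  open import Data.Product using (_,_; ∃-syntax; _×_; proj₁; proj₂)
  open import Data.Sum as Sum using (_⊎_; inj₁; inj₂; swap)
  open import Function using (_∘_)
  open import Relation.Binary using (DecidableEquality; Decidable)
  open import Relation.Binary.PropositionalEquality
  open import Relation.Nullary using (¬_; yes; no; contradiction; ¬?)
  open import Relation.Nullary.Decidable using (_×-dec_; _⊎-dec_)

  record Decodes {V : Set} {n} (c : Code n) (vs : Vec V n) (R : V → V → Set) : Set where
    field
      complete : ∀ {a b} → R a b → Edge c vs a b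
      sound    : ∀ {a b} → Edge c vs a b → R a b

  module _ {V : Set} (_≟_ : DecidableEquality V) where
    open import Data.Vec.Membership.DecPropositional _≟_ using (_∈?_)

    ∈-tail : ∀ {n z a} {vs : Vec V n} → a ∈ z ∷ vs → a ≢ z → a ∈ vs
    ∈-tail (here eq)  a≢z = contradiction eq a≢z
    ∈-tail (there a∈) _   = a∈

    module _ {m z} {vs : Vec V (2 + m)} (u : Unique (z ∷ vs)) {R : V → V → Set} (reg : TwoRegular R (z ∷ vs))
             (p : Pair m) (Rzx : R z (fstAt vs p)) (Rzy : R z (sndAt vs p))
             (Rxy : R (fstAt vs p) (sndAt vs p)) where
      open TwoRegular reg
      open TriFacts u p

      Without : V → V → Set
      Without a b = R a b × a ∈ removePair vs p

      -- A vertex of the triangle already has both its neighbours there. Hence the one-sided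
      -- condition in `Without` is symmetric.
      off-triangle : ∀ {a b} → R a b → a ∈ removePair vs p → b ∈ removePair vs p
      off-triangle {a} {b} Rab a∈ with support (symmetric Rab)
      ... | here refl with neighbour-of x≢y Rzx Rzy (symmetric Rab)
      ...   | inj₁ refl = contradiction a∈ x∉
      ...   | inj₂ refl = contradiction a∈ y∉
      off-triangle {a} {b} Rab a∈ | there b∈ with removePair-cover vs p b∈
      ... | inj₂ (inj₂ b∈′) = b∈′
      ... | inj₁ refl with neighbour-of z≢y (symmetric Rzx) Rxy (symmetric Rab)
      ...   | inj₁ refl = contradiction a∈ z∉
      ...   | inj₂ refl = contradiction a∈ y∉
      off-triangle {a} {b} Rab a∈ | there b∈ | inj₂ (inj₁ refl)
        with neighbour-of z≢x (symmetric Rzy) (symmetric Rxy) (symmetric Rab)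
      ...   | inj₁ refl = contradiction a∈ z∉
      ...   | inj₂ refl = contradiction a∈ x∉

      Without-regular : TwoRegular Without (removePair vs p)
      Without-regular = record
        { symmetric   = λ (Rab , a∈) → symmetric Rab , off-triangle Rab a∈
        ; irreflexive = λ (Raa , _) → irreflexive Raa
        ; support     = proj₂
        ; neighbours  = λ a∈ → let (s , t , s≢t , Ras , Rat , only) = neighbours (there (removePair-⊆ vs p a∈))
                               in s , t , s≢t , (Ras , a∈) , (Rat , a∈) , only ∘ proj₁
        }

      tri-decodes : ∀ {c} → Decodes c (removePair vs p) Without → Decodes (tri p c) (z ∷ vs) R
      tri-decodes {c} d = record { complete = complete ; sound = λ { (inj₁ e) → sound e ; (inj₂ e) → symmetric (sound e) } }
        where
        module D = Decodes d
        sound : ∀ {a b} → Arc (tri p c) (z ∷ vs) a b → R a b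
        sound (old e)          = proj₁ (D.sound (inj₁ e))
        sound (tri₁ refl refl) = Rzx
        sound (tri₂ refl refl) = Rxy
        sound (tri₃ refl refl) = symmetric Rzy
        complete : ∀ {a b} → R a b → Edge (tri p c) (z ∷ vs) a b
        complete {a} {b} Rab with support Rab
        ... | here refl with neighbour-of x≢y Rzx Rzy Rab
        ...   | inj₁ refl = inj₁ (tri₁ refl refl)
        ...   | inj₂ refl = inj₂ (tri₃ refl refl)
        complete {a} {b} Rab | there a∈ with removePair-cover vs p a∈
        ... | inj₂ (inj₂ a∈′) = Sum.map old old (D.complete (Rab , a∈′))
        ... | inj₁ refl with neighbour-of z≢y (symmetric Rzx) Rxy Rab
        ...   | inj₁ refl = inj₂ (tri₁ refl refl)
        ...   | inj₂ refl = inj₁ (tri₂ refl refl)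
        complete {a} {b} Rab | there a∈ | inj₂ (inj₁ refl)
          with neighbour-of z≢x (symmetric Rzy) (symmetric Rxy) Rab
        ...   | inj₁ refl = inj₁ (tri₃ refl refl)
        ...   | inj₂ refl = inj₂ (tri₂ refl refl)

    module _ {n z} {vs : Vec V n} (u : Unique (z ∷ vs)) {R : V → V → Set} (reg : TwoRegular R (z ∷ vs))
             (s t : V) (s≢t : s ≢ t) (Rzs : R z s) (Rzt : R z t) (¬Rst : ¬ R s t) where
      open TwoRegular reg

      -- The graph without `z`, its neighbours joined. As these were not adjacent, the added edge is
      -- new and both of them keep degree two.
      Suppressed : V → V → Set
      Suppressed a b = (R a b × a ≢ z × b ≢ z) ⊎ SamePair s t a b

      loop-free : ∀ {a b} → R a b → a ≢ b
      loop-free Raa refl = irreflexive Raa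

      s∈ : s ∈ vs
      s∈ = ∈-tail (support (symmetric Rzs)) (loop-free (symmetric Rzs))
      t∈ : t ∈ vs
      t∈ = ∈-tail (support (symmetric Rzt)) (loop-free (symmetric Rzt))

      -- The end a of the suppressed path a z b keeps its other neighbour and gains b.
      end-neighbours : ∀ {a b} → SamePair s t a b → R z a → ¬ R a b →
        ∃[ v ] ∃[ w ] (v ≢ w × Suppressed a v × Suppressed a w × (∀ {c} → Suppressed a c → c ≡ v ⊎ c ≡ w))
      end-neighbours {a} {b} same Rza ¬Rab with v , v≢z , Rav , only ← other-neighbour (symmetric Rza) =
        v , b , (λ { refl → ¬Rab Rav }) , inj₁ (Rav , loop-free (symmetric Rza) , v≢z) , inj₂ same , only′
        where
        same-end : ∀ {a b c} → SamePair s t a b → SamePair s t a c → c ≡ b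
        same-end (inj₁ (_ , refl)) (inj₁ (_ , refl)) = refl
        same-end (inj₁ (refl , _)) (inj₂ (eq , _))   = contradiction eq s≢t
        same-end (inj₂ (refl , _)) (inj₁ (eq , _))   = contradiction (sym eq) s≢t
        same-end (inj₂ (_ , refl)) (inj₂ (_ , refl)) = refl
        only′ : ∀ {c} → Suppressed a c → c ≡ v ⊎ c ≡ b
        only′ (inj₂ same′) = inj₂ (same-end same same′)
        only′ (inj₁ (Rac , _ , c≢z)) with only Rac
        ... | inj₁ eq = contradiction eq c≢z
        ... | inj₂ eq = inj₁ eq

      Suppressed-regular : TwoRegular Suppressed vs
      Suppressed-regular = record
        { symmetric   = λ { (inj₁ (Rab , a≢z , b≢z)) → inj₁ (symmetric Rab , b≢z , a≢z)
                          ; (inj₂ same) → inj₂ (SamePair-swap same) }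
        ; irreflexive = λ { (inj₁ (Raa , _)) → irreflexive Raa
                          ; (inj₂ (inj₁ (refl , eq))) → s≢t eq
                          ; (inj₂ (inj₂ (refl , eq))) → s≢t (sym eq) }
        ; support     = λ { (inj₁ (Rab , a≢z , _)) → ∈-tail (support Rab) a≢z
                          ; (inj₂ (inj₁ (refl , _))) → s∈
                          ; (inj₂ (inj₂ (refl , _))) → t∈ }
        ; neighbours  = nbrs
        }
        where
        nbrs : ∀ {a} → a ∈ vs →
          ∃[ v ] ∃[ w ] (v ≢ w × Suppressed a v × Suppressed a w × (∀ {c} → Suppressed a c → c ≡ v ⊎ c ≡ w))
        nbrs {a} a∈ with a ≟ s | a ≟ t
        ... | yes refl | _        = end-neighbours (inj₁ (refl , refl)) Rzs ¬Rst
        ... | no _     | yes refl = end-neighbours (inj₂ (refl , refl)) Rzt (¬Rst ∘ symmetric)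
        ... | no a≢s   | no a≢t with v , w , v≢w , Rav , Raw , only ← neighbours (there a∈) =
          v , w , v≢w , inj₁ (Rav , a≢z , far Rav) , inj₁ (Raw , a≢z , far Raw) , only′
          where
          a≢z : a ≢ z
          a≢z refl = Unique⇒∉ u a∈
          far : ∀ {c} → R a c → c ≢ z
          far Raz refl with neighbour-of s≢t Rzs Rzt (symmetric Raz)
          ... | inj₁ eq = a≢s eq
          ... | inj₂ eq = a≢t eq
          only′ : ∀ {c} → Suppressed a c → c ≡ v ⊎ c ≡ w
          only′ (inj₁ (Rac , _)) = only Rac
          only′ (inj₂ (inj₁ (eq , _))) = contradiction eq a≢s
          only′ (inj₂ (inj₂ (eq , _))) = contradiction eq a≢t

      -- An insertion is indexed by the source of its arc, so the direction that `c` gives to the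
      -- added edge must be known; `arc` records it.
      ins-decodes : ∀ {c} → Decodes c vs Suppressed → (arc : Arc c vs s t) → Decodes (ins c (Any.index s∈)) (z ∷ vs) R
      ins-decodes {c} d arc = record { complete = complete ; sound = λ { (inj₁ e) → sound e ; (inj₂ e) → symmetric (sound e) } }
        where
        module D = Decodes d
        i = Any.index s∈
        s≡ : s ≡ lookup vs i
        s≡ = Anyₚ.lookup-index s∈
        u′ = Unique-tail u
        sound : ∀ {a b} → Arc (ins c i) (z ∷ vs) a b → R a b
        sound (keep ne e) with D.sound (inj₁ e)
        ... | inj₁ (Rab , _)            = Rab
        ... | inj₂ (inj₁ (a≡s , _))     = contradiction (trans a≡s s≡) ne
        ... | inj₂ (inj₂ (refl , refl)) = contradiction e (Arc-asymmetric u′ arc)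
        sound (into eq refl) = subst (λ v → R v z) (trans s≡ (sym eq)) (symmetric Rzs)
        sound (out refl e) with refl ← Arc-functional u′ (subst (λ v → Arc c vs v t) s≡ arc) e = Rzt
        survive : ∀ {a b} → R a b → Arc c vs a b → Arc (ins c i) (z ∷ vs) a b
        survive {a} Rab e with a ≟ lookup vs i
        ... | no ne = keep ne e
        ... | yes a≡ with refl ← trans a≡ (sym s≡) with refl ← Arc-functional u′ arc e = contradiction Rab ¬Rst
        at-z : ∀ {b} → R z b → Edge (ins c i) (z ∷ vs) z b
        at-z Rzb with neighbour-of s≢t Rzs Rzt Rzb
        ... | inj₁ refl = inj₂ (into s≡ refl)
        ... | inj₂ refl = inj₁ (out refl (subst (λ v → Arc c vs v t) s≡ arc))
        complete : ∀ {a b} → R a b → Edge (ins c i) (z ∷ vs) a b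
        complete {a} {b} Rab with a ≟ z | b ≟ z
        ... | yes refl | _        = at-z Rab
        ... | no _     | yes refl = swap (at-z (symmetric Rab))
        ... | no a≢z   | no b≢z   with D.complete (inj₁ (Rab , a≢z , b≢z))
        ...   | inj₁ e = inj₁ (survive Rab e)
        ...   | inj₂ e = inj₂ (survive (symmetric Rab) e)

    Decodes-resp : ∀ {n} {c : Code n} {vs : Vec V n} {R S : V → V → Set} →
      (∀ {a b} → R a b → S a b) → (∀ {a b} → S a b → R a b) → Decodes c vs R → Decodes c vs S
    Decodes-resp R⇒S S⇒R d = record { complete = complete ∘ S⇒R ; sound = R⇒S ∘ sound }
      where open Decodes d

    code-surjective : ∀ n {vs : Vec V n} → Unique vs → (R : V → V → Set) → Decidable R → TwoRegular R vs →
      ∃[ c ] Decodes c vs R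
    code-surjective zero {[]} u R R? reg = nil , record
      { complete = λ Rab → contradiction (TwoRegular.support reg Rab) λ () ; sound = λ { (inj₁ ()) ; (inj₂ ()) } }
    code-surjective (suc n) {z ∷ vs} u R R? reg
      with s , t , s≢t , Rzs , Rzt , _ ← TwoRegular.neighbours reg (here refl) with R? s t
    ... | no ¬Rst with c , d ← code-surjective n (Unique-tail u) (Suppressed u reg s t s≢t Rzs Rzt ¬Rst)
                         (λ a b → (R? a b ×-dec ¬? (a ≟ z) ×-dec ¬? (b ≟ z)) ⊎-dec
                                  ((a ≟ s ×-dec b ≟ t) ⊎-dec (a ≟ t ×-dec b ≟ s)))
                         (Suppressed-regular u reg s t s≢t Rzs Rzt ¬Rst)
                  -- The smaller code orients the added edge one way or the other; in the second
                  -- case `s` and `t` exchange roles.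
                  with Decodes.complete d (inj₂ (inj₁ (refl , refl)))
    ...   | inj₁ arc = _ , ins-decodes u reg s t s≢t Rzs Rzt ¬Rst d arc
    ...   | inj₂ arc = _ , ins-decodes u reg t s (s≢t ∘ sym) Rzt Rzs (¬Rst ∘ TwoRegular.symmetric reg)
                             (Decodes-resp (Sum.map (λ r → r) swap) (Sum.map (λ r → r) swap) d) arc
    code-surjective (suc n) {z ∷ vs} u R R? reg | yes Rst = by-triangle n vs u reg
        (∈-tail (support (symmetric Rzs)) (λ { refl → irreflexive Rzs }))
        (∈-tail (support (symmetric Rzt)) (λ { refl → irreflexive Rzt }))
      where
      open TwoRegular reg
      oriented : ∀ {x y} → SamePair s t x y → R z x × R z y × R x y
      oriented (inj₁ (refl , refl)) = Rzs , Rzt , Rst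
      oriented (inj₂ (refl , refl)) = Rzt , Rzs , symmetric Rst
      -- The size is generalised because a triangle takes two vertices out of `vs`: the presence of
      -- the distinct `s` and `t` forces the form 2 + m, and the recursion continues at m.
      by-triangle : ∀ n (vs : Vec V n) → Unique (z ∷ vs) → TwoRegular R (z ∷ vs) → s ∈ vs → t ∈ vs →
        ∃[ c ] Decodes c (z ∷ vs) R
      by-triangle (suc zero) (_ ∷ []) _ _ (here refl) (here refl) = contradiction refl s≢t
      by-triangle (suc (suc m)) vs u reg s∈ t∈
        with p , same ← pair-exists s∈ t∈ s≢t
        with Rzx , Rzy , Rxy ← oriented same
        with c , d ← code-surjective m (removePair-unique (Unique-tail u) p)
                       (Without u reg p Rzx Rzy Rxy)
                       (λ a b → R? a b ×-dec (a ∈? removePair vs p)) (Without-regular u reg p Rzx Rzy Rxy)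
        = tri p c , tri-decodes u reg p Rzx Rzy Rxy d

open CodeSurjectivity

-- The hopping number is three times the number of cycles.

module HoppingNumber where
  open import Defs
  open import Data.Nat using (suc; _+_; _*_; _≤_; z≤n; s≤s)
  open import Data.Nat.Properties using (≤-trans; ≤-reflexive; *-suc; m≤n⇒m≤1+n; +-suc; module ≤-Reasoning)
  open import Data.Fin using (Fin; _≟_)
  open import Data.Fin.Subset using (Subset; inside; outside; _∈_; _∪_; _⊆_; ⁅_⁆; ⊥; ∣_∣; _-_)
  open import Data.Fin.Subset.Properties
    using (_∈?_; ∉⊥; x∈⁅x⁆; x∈⁅y⁆⇒x≡y; x∈p∪q⁺; x∈p∪q⁻; p⊆p∪q; ∣⊥∣≡0; ∣⁅x⁆∣≡1; x∈p⇒∣p-x∣<∣p∣; x∈p∧x≢y⇒x∈p-y)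
  open import Data.List as List using (List; []; _∷_; length)
  open import Data.List.Membership.Propositional using () renaming (_∈_ to _∈ˡ_)
  import Data.List.Membership.Propositional.Properties as ∈ˡ
  open import Data.List.Relation.Unary.Any using (here; there)
  import Data.List.Relation.Unary.All as All
  open import Data.List.Relation.Unary.AllPairs using ([]; _∷_)
  open import Data.List.Relation.Unary.Unique.Propositional using () renaming (Unique to Uniqueˡ)
  open import Data.Vec as Vec using (Vec; []; _∷_)
  open import Data.Vec.Membership.Propositional.Properties using (∈-allFin⁺)
  open import Data.Vec.Relation.Unary.Unique.Propositional using (Unique)
  open import Data.Vec.Relation.Unary.Unique.Propositional.Properties using (tabulate⁺)
  open import Data.Product using (_,_; ∃-syntax; _×_; proj₁; proj₂)
  open import Data.Sum using (inj₁; inj₂)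
  open import Function using (_∘_; id)
  open import Relation.Binary.Construct.Closure.ReflexiveTransitive using (Star; ε; _◅_; _◅◅_)
  open import Relation.Binary.PropositionalEquality
  open import Relation.Nullary using (yes; no; contradiction)

  ∣p∪q∣≤∣p∣+∣q∣ : ∀ {n} (p q : Subset n) → ∣ p ∪ q ∣ ≤ ∣ p ∣ + ∣ q ∣
  ∣p∪q∣≤∣p∣+∣q∣ []            []            = z≤n
  ∣p∪q∣≤∣p∣+∣q∣ (outside ∷ p) (outside ∷ q) = ∣p∪q∣≤∣p∣+∣q∣ p q
  ∣p∪q∣≤∣p∣+∣q∣ (outside ∷ p) (inside ∷ q)  = ≤-trans (s≤s (∣p∪q∣≤∣p∣+∣q∣ p q)) (≤-reflexive (sym (+-suc ∣ p ∣ ∣ q ∣)))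
  ∣p∪q∣≤∣p∣+∣q∣ (inside ∷ p)  (outside ∷ q) = s≤s (∣p∪q∣≤∣p∣+∣q∣ p q)
  ∣p∪q∣≤∣p∣+∣q∣ (inside ∷ p)  (inside ∷ q)  =
    s≤s (≤-trans (m≤n⇒m≤1+n (∣p∪q∣≤∣p∣+∣q∣ p q)) (≤-reflexive (sym (+-suc ∣ p ∣ ∣ q ∣))))

  ∣⁅x⁆∪p∣≤1+∣p∣ : ∀ {n} (x : Fin n) p → ∣ ⁅ x ⁆ ∪ p ∣ ≤ suc ∣ p ∣
  ∣⁅x⁆∪p∣≤1+∣p∣ x p = ≤-trans (∣p∪q∣≤∣p∣+∣q∣ ⁅ x ⁆ p) (≤-reflexive (cong (_+ ∣ p ∣) (∣⁅x⁆∣≡1 x)))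

  allFin-unique : ∀ n → Unique (Vec.allFin n)
  allFin-unique n = tabulate⁺ id

  record Triple {n} (f : Fin n → Fin n) (B : Subset n) (r : Fin n) : Set where
    field
      {x y z}      : Fin n
      x≢y          : x ≢ y
      x≢z          : x ≢ z
      y≢z          : y ≢ z
      x∈           : x ∈ B
      y∈           : y ∈ B
      z∈           : z ∈ B
      fx≡r         : f x ≡ r
      fy≡r         : f y ≡ r
      fz≡r         : f z ≡ r

  Triple-restrict : ∀ {n} {f : Fin n → Fin n} {B B′ r} → (∀ {v} → v ∈ B → f v ≡ r → v ∈ B′) →
    Triple f B r → Triple f B′ r
  Triple-restrict h T = record
    { x≢y = T.x≢y ; x≢z = T.x≢z ; y≢z = T.y≢z
    ; x∈ = h T.x∈ T.fx≡r ; y∈ = h T.y∈ T.fy≡r ; z∈ = h T.z∈ T.fz≡r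
    ; fx≡r = T.fx≡r ; fy≡r = T.fy≡r ; fz≡r = T.fz≡r }
    where module T = Triple T

  -- Triples for different r lie in different fibres of `f`, so deleting one of them from `B` leaves
  -- the others intact.
  triples-bound : ∀ {n} (f : Fin n → Fin n) (B : Subset n) rs → Uniqueˡ rs →
    (∀ {r} → r ∈ˡ rs → Triple f B r) → 3 * length rs ≤ ∣ B ∣
  triples-bound f B []       _        _ = z≤n
  triples-bound f B (r ∷ rs) (r≢ ∷ u) T = begin
    3 * suc (length rs)          ≡⟨ *-suc 3 (length rs) ⟩
    3 + 3 * length rs            ≤⟨ s≤s (s≤s (s≤s (triples-bound f B₃ rs u T′))) ⟩
    3 + ∣ B₃ ∣                   ≤⟨ s≤s (s≤s (x∈p⇒∣p-x∣<∣p∣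
                                      (x∈p∧x≢y⇒x∈p-y (x∈p∧x≢y⇒x∈p-y R.z∈ (R.x≢z ∘ sym)) (R.y≢z ∘ sym)))) ⟩
    2 + ∣ B - R.x - R.y ∣        ≤⟨ s≤s (x∈p⇒∣p-x∣<∣p∣ (x∈p∧x≢y⇒x∈p-y R.y∈ (R.x≢y ∘ sym))) ⟩
    1 + ∣ B - R.x ∣              ≤⟨ x∈p⇒∣p-x∣<∣p∣ R.x∈ ⟩
    ∣ B ∣                        ∎
    where
    open ≤-Reasoning
    module R = Triple (T (here refl))
    B₃ = B - R.x - R.y - R.z
    T′ : ∀ {r′} → r′ ∈ˡ rs → Triple f B₃ r′
    T′ {r′} r′∈ = Triple-restrict keep-v (T (there r′∈))
      where
      keep-v : ∀ {v} → v ∈ B → f v ≡ r′ → v ∈ B₃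
      keep-v {v} v∈ fv≡r′ =
        x∈p∧x≢y⇒x∈p-y (x∈p∧x≢y⇒x∈p-y (x∈p∧x≢y⇒x∈p-y v∈ (differ R.fx≡r)) (differ R.fy≡r)) (differ R.fz≡r)
        where
        differ : ∀ {w} → f w ≡ r → v ≢ w
        differ fw≡r refl = All.lookup r≢ r′∈ (trans (sym fw≡r) fv≡r′)

  module _ {n} (G : Graph n) (c : Code n) (d : Decodes c (Vec.allFin n) (Adj G)) where
    open Decodes d
    private
      vs = Vec.allFin n
      uniq = allFin-unique n
      reps = representatives _≟_ c vs
      rep = representative _≟_ c vs

      σ π : Fin n → Fin n
      σ v = proj₁ (Arc-next _≟_ c (∈-allFin⁺ v))
      π v = proj₁ (Arc-prev _≟_ c (∈-allFin⁺ v))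

      arc-σ : ∀ v → Arc c vs v (σ v)
      arc-σ v = proj₂ (Arc-next _≟_ c (∈-allFin⁺ v))

      arc-π : ∀ v → Arc c vs (π v) v
      arc-π v = proj₂ (Arc-prev _≟_ c (∈-allFin⁺ v))

      rep-adj : ∀ {a b} → Adj G a b → rep a ≡ rep b
      rep-adj ab with complete ab
      ... | inj₁ e = representative-arc _≟_ uniq e
      ... | inj₂ e = sym (representative-arc _≟_ uniq e)

      -- The triple consists of `v`, its successor and its predecessor, which differ as cycles have
      -- length at least three.
      around : ∀ {B} v → v ∈ B → (∀ w → Adj G v w → w ∈ B) → Triple rep B (rep v)
      around v v∈ nbrs = record
        { x = v ; y = σ v ; z = π v
        ; x≢y = λ eq → Arc-irreflexive uniq (subst (Arc c vs v) (sym eq) (arc-σ v))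
        ; x≢z = λ eq → Arc-irreflexive uniq (subst (λ x → Arc c vs x v) (sym eq) (arc-π v))
        ; y≢z = λ eq → Arc-asymmetric uniq (arc-σ v) (subst (λ x → Arc c vs x v) (sym eq) (arc-π v))
        ; x∈ = v∈ ; y∈ = nbrs (σ v) (sound (inj₁ (arc-σ v))) ; z∈ = nbrs (π v) (sound (inj₂ (arc-π v)))
        ; fx≡r = refl ; fy≡r = sym (representative-arc _≟_ uniq (arc-σ v)) ; fz≡r = representative-arc _≟_ uniq (arc-π v) }

      -- The first force into the class of r is made by a vertex of that class which is blue together
      -- with both its neighbours; until then the blue part of the class is the initial one.
      triple-in-start : ∀ {Bl U Bl′ U′} → Star (HopStep G) (Bl , U) (Bl′ , U′) → (∀ v → v ∈ Bl′) →
        ∀ {r} → rep r ≡ r → Triple rep Bl r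
      triple-in-start ε all {r} fixed = subst (Triple rep _) fixed (around r (all r) (λ w _ → all w))
      triple-in-start (force {Bl} b w b∈ _ _ (_ , _ , m , bm , mw) nbrs ◅ steps) all {r} fixed with rep w ≟ r
      ... | yes eq = subst (Triple rep Bl) (trans (trans (rep-adj bm) (rep-adj mw)) eq) (around b b∈ nbrs)
      ... | no ne  = Triple-restrict undo (triple-in-start steps all fixed)
        where
        undo : ∀ {v} → v ∈ Bl ∪ ⁅ w ⁆ → rep v ≡ r → v ∈ Bl
        undo v∈ eq with x∈p∪q⁻ Bl ⁅ w ⁆ v∈
        ... | inj₁ v∈Bl = v∈Bl
        ... | inj₂ v∈w with refl ← x∈⁅y⁆⇒x≡y w v∈w = contradiction eq ne

    hopping-≥ : ∀ B → Feasible G B → 3 * cycles c ≤ ∣ B ∣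
    hopping-≥ B (_ , _ , steps , all) =
      subst (λ k → 3 * k ≤ ∣ B ∣) (length-representatives _≟_ c vs)
        (triples-bound rep B reps (representatives-unique _≟_ c uniq)
          (λ r∈ → triple-in-start steps all (representative-fixed _≟_ c uniq r∈)))

    private
      seed : List (Fin n) → Subset n
      seed []       = ⊥
      seed (r ∷ rs) = ⁅ r ⁆ ∪ (⁅ σ r ⁆ ∪ (⁅ σ (σ r) ⁆ ∪ seed rs))

      ∣seed∣ : ∀ rs → ∣ seed rs ∣ ≤ 3 * length rs
      ∣seed∣ []       = ≤-reflexive (∣⊥∣≡0 n)
      ∣seed∣ (r ∷ rs) = begin
        ∣ seed (r ∷ rs) ∣                                ≤⟨ ∣⁅x⁆∪p∣≤1+∣p∣ r _ ⟩
        1 + ∣ ⁅ σ r ⁆ ∪ (⁅ σ (σ r) ⁆ ∪ seed rs) ∣        ≤⟨ s≤s (∣⁅x⁆∪p∣≤1+∣p∣ (σ r) _) ⟩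
        2 + ∣ ⁅ σ (σ r) ⁆ ∪ seed rs ∣                    ≤⟨ s≤s (s≤s (∣⁅x⁆∪p∣≤1+∣p∣ (σ (σ r)) _)) ⟩
        3 + ∣ seed rs ∣                                  ≤⟨ s≤s (s≤s (s≤s (∣seed∣ rs))) ⟩
        3 + 3 * length rs                                ≡⟨ *-suc 3 (length rs) ⟨
        3 * length (r ∷ rs)                              ∎
        where open ≤-Reasoning

      Seeded : Subset n → Fin n → Set
      Seeded Bl v = v ∈ Bl × σ v ∈ Bl × σ (σ v) ∈ Bl

      seeded : ∀ {rs r} → r ∈ˡ rs → Seeded (seed rs) r
      seeded {r ∷ rs} (here refl) =
        x∈p∪q⁺ (inj₁ (x∈⁅x⁆ r)) , x∈p∪q⁺ (inj₂ (x∈p∪q⁺ (inj₁ (x∈⁅x⁆ (σ r))))) ,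
        x∈p∪q⁺ (inj₂ (x∈p∪q⁺ (inj₂ (x∈p∪q⁺ (inj₁ (x∈⁅x⁆ (σ (σ r))))))))
      seeded {r ∷ rs} (there r∈) with a , b , e ← seeded r∈ = lift a , lift b , lift e
        where
        lift : ∀ {v} → v ∈ seed rs → v ∈ seed (r ∷ rs)
        lift v∈ = x∈p∪q⁺ (inj₂ (x∈p∪q⁺ (inj₂ (x∈p∪q⁺ (inj₂ v∈)))))

      -- Forces only go from a vertex v to σ (σ v), so v has not forced as long as σ (σ v) is white.
      Forward : State n → Set
      Forward (Bl , U) = ∀ {v} → v ∈ U → σ (σ v) ∈ Bl

      -- A run carries along that blue vertices stay blue and that forces have only gone forward, so
      -- that runs can be concatenated.
      Reaches : State n → (Subset n → Set) → Set
      Reaches s@(Bl , _) P = ∃[ Bl′ ] ∃[ U′ ] (Star (HopStep G) s (Bl′ , U′) × Forward (Bl′ , U′) × Bl ⊆ Bl′ × P Bl′)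

      -- A window of three blue vertices moves one step along its cycle: its middle vertex forces
      -- the vertex after the window, unless that one is already blue.
      hop : ∀ {Bl U} v → Forward (Bl , U) → Seeded Bl v → Reaches (Bl , U) (λ Bl′ → Seeded Bl′ (σ v))
      hop {Bl} {U} v fwd (v∈ , σv∈ , σσv∈) with σ (σ (σ v)) ∈? Bl
      ... | yes w∈ = Bl , U , ε , fwd , id , σv∈ , σσv∈ , w∈
      -- By `Forward`, a previous force by `σ v` would have made `w` blue.
      ... | no w∉  = Bl ∪ ⁅ w ⁆ , U ∪ ⁅ b ⁆ , force b w σv∈ (w∉ ∘ fwd) w∉ dist nbrs ◅ ε , fwd′ , grow ,
                     grow σv∈ , grow σσv∈ , x∈p∪q⁺ (inj₂ (x∈⁅x⁆ w))
        where
        b = σ v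
        w = σ (σ b)
        grow : Bl ⊆ Bl ∪ ⁅ w ⁆
        grow = p⊆p∪q ⁅ w ⁆
        nbrs : ∀ u → Adj G b u → u ∈ Bl
        nbrs u bu with complete bu
        ... | inj₁ e = subst (_∈ Bl) (Arc-functional uniq (arc-σ b) e) σσv∈
        ... | inj₂ e = subst (_∈ Bl) (Arc-injective uniq (arc-σ v) e) v∈
        dist : Dist2 G b w
        -- The vertex `b` and all its neighbours are blue, so the white `w` is none of them.
        dist = (λ eq → w∉ (subst (_∈ Bl) eq σv∈)) , (λ bw → w∉ (nbrs w bw)) ,
               σ b , sound (inj₁ (arc-σ b)) , sound (inj₁ (arc-σ (σ b)))
        fwd′ : Forward (Bl ∪ ⁅ w ⁆ , U ∪ ⁅ b ⁆)
        fwd′ x∈ with x∈p∪q⁻ U ⁅ b ⁆ x∈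
        ... | inj₁ x∈U = grow (fwd x∈U)
        ... | inj₂ x∈b with refl ← x∈⁅y⁆⇒x≡y b x∈b = x∈p∪q⁺ (inj₂ (x∈⁅x⁆ w))

      walk : ∀ {Bl U r v} → Star (Arc c vs) r v → Forward (Bl , U) → Seeded Bl r → Reaches (Bl , U) (v ∈_)
      walk ε fwd (v∈ , _) = _ , _ , ε , fwd , id , v∈
      walk {r = r} (e ◅ path) fwd seeds with refl ← Arc-functional uniq (arc-σ r) e
        with _ , _ , steps , fwd′ , ⊆₁ , seeds′ ← hop r fwd seeds
        with _ , _ , steps′ , fwd″ , ⊆₂ , v∈ ← walk path fwd′ seeds′ =
        _ , _ , steps ◅◅ steps′ , fwd″ , ⊆₂ ∘ ⊆₁ , v∈

      -- One target vertex is reached at a time; the seeds stay available because the blue set only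
      -- grows.
      cover : ∀ xs {Bl U} → Forward (Bl , U) → (∀ {r} → r ∈ˡ reps → Seeded Bl r) →
        Reaches (Bl , U) (λ Bl′ → ∀ {v} → v ∈ˡ xs → v ∈ Bl′)
      cover [] fwd seeds = _ , _ , ε , fwd , id , λ ()
      cover (x ∷ xs) fwd seeds
        with r , r∈ , path ← reachable _≟_ c (∈-allFin⁺ x)
        with _ , _ , steps , fwd′ , ⊆₁ , x∈ ← walk path fwd (seeds r∈)
        with _ , _ , steps′ , fwd″ , ⊆₂ , xs∈ ←
          cover xs fwd′ (λ r∈ → let (a , b , e) = seeds r∈ in ⊆₁ a , ⊆₁ b , ⊆₁ e) =
        _ , _ , steps ◅◅ steps′ , fwd″ , ⊆₂ ∘ ⊆₁ , λ { (here refl) → ⊆₂ x∈ ; (there v∈) → xs∈ v∈ }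

    hopping-≤ : ∃[ B ] (Feasible G B × ∣ B ∣ ≤ 3 * cycles c)
    hopping-≤ with Bl , U , steps , _ , _ , all ← cover (List.allFin n) {U = ⊥} (λ v∈ → contradiction v∈ ∉⊥) seeded =
      seed reps , (Bl , U , steps , λ v → all (∈ˡ.∈-allFin v)) ,
      ≤-trans (∣seed∣ reps) (≤-reflexive (cong (3 *_) (length-representatives _≟_ c vs)))

open HoppingNumber

-- Adjacency matrices against codes, and Markov's inequality.

module RandomGraphs where
  open import Defs
  open import Data.Nat using (ℕ; suc; _+_; _*_; _≤_; _<_; z≤n; s≤s; NonZero; >-nonZero; _≡ᵇ_)
  open import Data.Nat.Properties
    using (≤-trans; ≤-reflexive; ≤-antisym; *-monoˡ-≤; +-mono-≤; *-cancelʳ-≤; *-assoc; *-comm; *-distribʳ-+; ≡ᵇ⇒≡; ≡⇒≡ᵇ; +-suc; module ≤-Reasoning)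
  open import Data.Nat.ListAction using (sum)
  open import Data.Bool using (Bool; true; false; T; _∧_; if_then_else_) renaming (_≟_ to _≟ᵇ_)
  open import Data.Bool.ListAction using (and)
  open import Data.Bool.Properties using (T-∧; T?)
  open import Data.Fin using (Fin; _≟_)
  open import Data.List using (List; []; _∷_; map; length; allFin; filterᵇ)
  open import Data.List.Properties using (length-map)
  open import Data.List.Membership.Propositional using (_∈_)
  open import Data.List.Membership.Propositional.Properties
    using (∈-map⁺; ∈-map⁻; ∈-concat⁺′; ∈-filter⁺; ∈-filter⁻; ∈-allFin)
  open import Data.List.Relation.Unary.Any using (here; there)
  open import Data.List.Relation.Unary.All as All using (All; []; _∷_)
  open import Data.List.Relation.Unary.AllPairs using ([]; _∷_)
  open import Data.List.Relation.Unary.Unique.Propositional using (Unique)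
  import Data.List.Relation.Unary.Unique.Propositional.Properties as Uniqueₚ
  open import Data.Vec as Vec using (Vec; []; _∷_; lookup; tabulate)
  open import Data.Vec.Properties using (tabulate∘lookup; tabulate-cong; lookup∘tabulate)
  open import Data.Vec.Membership.Propositional.Properties using (∈-allFin⁺)
  open import Data.Product using (_,_; ∃-syntax; _×_; proj₁; proj₂)
  open import Data.Sum as Sum using (_⊎_; inj₁; inj₂)
  open import Function using (_∘_; Equivalence)
  open import Relation.Binary.PropositionalEquality
  open import Relation.Nullary using (Dec; yes; contradiction; does)
  open import Relation.Nullary.Decidable using (_⊎-dec_; dec-true)

  T-and⁻ : ∀ {A : Set} (f : A → Bool) xs → T (and (map f xs)) → ∀ {x} → x ∈ xs → T (f x)
  T-and⁻ f (x ∷ xs) t (here refl) = proj₁ (Equivalence.to (T-∧ {f x}) t)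
  T-and⁻ f (x ∷ xs) t (there x∈)  = T-and⁻ f xs (proj₂ (Equivalence.to (T-∧ {f x}) t)) x∈

  T-and⁺ : ∀ {A : Set} (f : A → Bool) xs → (∀ x → T (f x)) → T (and (map f xs))
  T-and⁺ f []       h = _
  T-and⁺ f (x ∷ xs) h = Equivalence.from (T-∧ {f x}) (h x , T-and⁺ f xs h)

  ≡⇒T : ∀ {b} → b ≡ true → T b
  ≡⇒T refl = _

  T⇒≡ : ∀ {b} → T b → b ≡ true
  T⇒≡ {true} _ = refl

  ==ᵇ⇒≡ : ∀ a b → T (a ==ᵇ b) → a ≡ b
  ==ᵇ⇒≡ true  true  _ = refl
  ==ᵇ⇒≡ false false _ = refl

  ≡⇒==ᵇ : ∀ a → T (a ==ᵇ a)
  ≡⇒==ᵇ true  = _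
  ≡⇒==ᵇ false = _

  does⇒ : ∀ {P : Set} (P? : Dec P) → does P? ≡ true → P
  does⇒ (yes p) _ = p

  T-not⁻ : ∀ b → T (not' b) → b ≢ true
  T-not⁻ false _ ()

  T-not⁺ : ∀ b → b ≢ true → T (not' b)
  T-not⁺ true  h = contradiction refl h
  T-not⁺ false h = _

  sum-indicator : ∀ {A : Set} (f : A → Bool) xs →
    sum (map (λ v → if f v then 1 else 0) xs) ≡ length (filterᵇ f xs)
  sum-indicator f []       = refl
  sum-indicator f (x ∷ xs) with f x
  ... | true  = cong suc (sum-indicator f xs)
  ... | false = sum-indicator f xs

  bool-ext : ∀ {a b} → (a ≡ true → b ≡ true) → (b ≡ true → a ≡ true) → a ≡ b
  bool-ext {true}  {b}     h _ = sym (h refl)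
  bool-ext {false} {true}  _ k = k refl
  bool-ext {false} {false} _ _ = refl

  module _ {n} (G : Graph n) where
    private
      vs = Vec.allFin n
      nbrs : Fin n → List (Fin n)
      nbrs u = filterᵇ (adjᵇ G u) (allFin n)

      ∈-nbrs⁺ : ∀ {u v} → Adj G u v → v ∈ nbrs u
      ∈-nbrs⁺ {u} {v} uv = ∈-filter⁺ (T? ∘ adjᵇ G u) (∈-allFin v) (≡⇒T uv)

      ∈-nbrs⁻ : ∀ {u v} → v ∈ nbrs u → Adj G u v
      ∈-nbrs⁻ {u} v∈ = T⇒≡ (proj₂ (∈-filter⁻ (T? ∘ adjᵇ G u) {xs = allFin n} v∈))

      nbrs-unique : ∀ u → Unique (nbrs u)
      nbrs-unique u = Uniqueₚ.filter⁺ (T? ∘ adjᵇ G u) (Uniqueₚ.allFin⁺ n)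

    Is2Regular⇒TwoRegular : Is2Regular G → TwoRegular (Adj G) vs
    Is2Regular⇒TwoRegular reg = record
      { symmetric   = λ {a} {b} ab → trans (sym (==ᵇ⇒≡ _ _ (T-and⁻ _ (allFin n) (sym-at a) (∈-allFin b)))) ab
      ; irreflexive = λ {a} → T-not⁻ _ (loop-at a)
      ; support     = λ {a} _ → ∈-allFin⁺ a
      ; neighbours  = λ {a} _ → two (nbrs-unique a)
          (trans (sym (sum-indicator (adjᵇ G a) (allFin n))) (≡ᵇ⇒≡ _ 2 (degree-at a))) ∈-nbrs⁺ ∈-nbrs⁻
      }
      where
      at : ∀ a → T (not' (adjᵇ G a a) ∧ (degree G a ≡ᵇ 2) ∧ and (map (λ v → adjᵇ G a v ==ᵇ adjᵇ G v a) (allFin n)))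
      at a = T-and⁻ _ (allFin n) reg (∈-allFin a)
      loop-at : ∀ a → T (not' (adjᵇ G a a))
      loop-at a = proj₁ (Equivalence.to T-∧ (at a))
      degree-at : ∀ a → T (degree G a ≡ᵇ 2)
      degree-at a = proj₁ (Equivalence.to T-∧ (proj₂ (Equivalence.to (T-∧ {not' (adjᵇ G a a)}) (at a))))
      sym-at : ∀ a → T (and (map (λ v → adjᵇ G a v ==ᵇ adjᵇ G v a) (allFin n)))
      sym-at a = proj₂ (Equivalence.to (T-∧ {degree G a ≡ᵇ 2}) (proj₂ (Equivalence.to (T-∧ {not' (adjᵇ G a a)}) (at a))))
      two : ∀ {xs : List (Fin n)} {P : Fin n → Set} → Unique xs → length xs ≡ 2 →
        (∀ {v} → P v → v ∈ xs) → (∀ {v} → v ∈ xs → P v) →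
        ∃[ u ] ∃[ w ] (u ≢ w × P u × P w × (∀ {b} → P b → b ≡ u ⊎ b ≡ w))
      two {u ∷ w ∷ []} ((u≢w ∷ []) ∷ _) refl P⊆ ⊆P = u , w , u≢w , ⊆P (here refl) , ⊆P (there (here refl)) ,
        λ Pb → only (P⊆ Pb)
        where
        only : ∀ {b} → b ∈ u ∷ w ∷ [] → b ≡ u ⊎ b ≡ w
        only (here eq)         = inj₁ eq
        only (there (here eq)) = inj₂ eq

    TwoRegular⇒Is2Regular : TwoRegular (Adj G) vs → Is2Regular G
    TwoRegular⇒Is2Regular reg = T-and⁺ _ (allFin n) λ a →
      Equivalence.from T-∧ (T-not⁺ _ irreflexive ,
      Equivalence.from T-∧ (≡⇒≡ᵇ _ 2 (trans (sum-indicator (adjᵇ G a) (allFin n)) (degree-2 a)) ,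
      T-and⁺ _ (allFin n) λ b →
        subst (λ x → T (adjᵇ G a b ==ᵇ x)) (bool-ext symmetric symmetric) (≡⇒==ᵇ (adjᵇ G a b))))
      where
      open TwoRegular reg
      degree-2 : ∀ a → length (nbrs a) ≡ 2
      degree-2 a with u , w , u≢w , au , aw , only ← neighbours (∈-allFin⁺ a) =
        ≤-antisym (length-≤ {ys = u ∷ w ∷ []} (nbrs-unique a)
                    λ v∈ → Sum.[ (λ { refl → here refl }) , (λ { refl → there (here refl) }) ]′ (only (∈-nbrs⁻ v∈)))
                  (length-≤ {xs = u ∷ w ∷ []} ((u≢w ∷ []) ∷ [] ∷ [])
                    λ { (here refl) → ∈-nbrs⁺ au ; (there (here refl)) → ∈-nbrs⁺ aw })

  graph-ext : ∀ {n} {G H : Graph n} → (∀ {a b} → Adj G a b → Adj H a b) → (∀ {a b} → Adj H a b → Adj G a b) → G ≡ H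
  graph-ext {n} {G} {H} G⇒H H⇒G = vec-ext λ a → vec-ext λ b → bool-ext G⇒H H⇒G
    where
    vec-ext : ∀ {A : Set} {k} {xs ys : Vec A k} → (∀ i → lookup xs i ≡ lookup ys i) → xs ≡ ys
    vec-ext {xs = xs} {ys} eq = trans (sym (tabulate∘lookup xs)) (trans (tabulate-cong eq) (tabulate∘lookup ys))

  ∈-allVecs : ∀ {A : Set} {k} (xs : List A) → (∀ x → x ∈ xs) → (v : Vec A k) → v ∈ allVecs k xs
  ∈-allVecs xs all []      = here refl
  ∈-allVecs {k = suc k} xs all (x ∷ v) =
    ∈-concat⁺′ (∈-map⁺ (x ∷_) (∈-allVecs xs all v)) (∈-map⁺ (λ x → map (x ∷_) (allVecs k xs)) (all x))

  ∈-allGraphs : ∀ {n} (G : Graph n) → G ∈ allGraphs n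
  ∈-allGraphs = ∈-allVecs _ (∈-allVecs _ λ { true → here refl ; false → there (here refl) })

  module _ {n : ℕ} where
    private vs = Vec.allFin n

    private
      next : Code n → Fin n → Fin n
      next c a = proj₁ (Arc-next _≟_ c (∈-allFin⁺ a))

      edge? : (c : Code n) (a b : Fin n) → Dec (next c a ≡ b ⊎ next c b ≡ a)
      edge? c a b = (next c a ≟ b) ⊎-dec (next c b ≟ a)

    -- Adjacency is decided through the successor function, since `Edge` is given only as an
    -- inductive relation; `Arc-functional` makes the two agree.
    toGraph : Code n → Graph n
    toGraph c = tabulate λ a → tabulate λ b → does (edge? c a b)

    toGraph-decodes : ∀ c → Decodes c vs (Adj (toGraph c))
    toGraph-decodes c = record { complete = complete ; sound = sound }
      where
      adjᵇ-toGraph : ∀ a b → adjᵇ (toGraph c) a b ≡ does (edge? c a b)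
      adjᵇ-toGraph a b = trans (cong (λ row → lookup row b) (lookup∘tabulate _ a)) (lookup∘tabulate _ b)
      arc : ∀ a → Arc c vs a (next c a)
      arc a = proj₂ (Arc-next _≟_ c (∈-allFin⁺ a))
      complete : ∀ {a b} → Adj (toGraph c) a b → Edge c vs a b
      complete {a} {b} ab = Sum.map (λ { refl → arc a }) (λ { refl → arc b })
        (does⇒ (edge? c a b) (trans (sym (adjᵇ-toGraph a b)) ab))
      sound : ∀ {a b} → Edge c vs a b → Adj (toGraph c) a b
      sound {a} {b} e = trans (adjᵇ-toGraph a b) (dec-true (edge? c a b)
        (Sum.map (Arc-functional (allFin-unique n) (arc a)) (Arc-functional (allFin-unique n) (arc b)) e))

    decode-unique : ∀ {c c′} {R : Fin n → Fin n → Set} → Decodes c vs R → Decodes c′ vs R → c ≡ c′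
    decode-unique {c} {c′} d d′ = code-injective _≟_ (allFin-unique n) c c′ (D′.complete ∘ D.sound) (D.complete ∘ D′.sound)
      where
      module D = Decodes d
      module D′ = Decodes d′

    toGraph-injective : ∀ {c c′} → toGraph c ≡ toGraph c′ → c ≡ c′
    toGraph-injective {c} {c′} eq =
      decode-unique (toGraph-decodes c) (subst (Decodes c′ vs ∘ Adj) (sym eq) (toGraph-decodes c′))

    toGraph-regular : ∀ c → Is2Regular (toGraph c)
    toGraph-regular c = TwoRegular⇒Is2Regular (toGraph c) record
      { symmetric = sound ∘ E.symmetric ∘ complete
      ; irreflexive = E.irreflexive ∘ complete
      ; support = E.support ∘ complete
      ; neighbours = λ a∈ → let (u , w , u≢w , au , aw , only) = E.neighbours a∈
                            in u , w , u≢w , sound au , sound aw , only ∘ complete }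
      where
      open Decodes (toGraph-decodes c)
      module E = TwoRegular (Edge-regular _≟_ c (allFin-unique n))

    codeOf : ∀ {G : Graph n} → Is2Regular G → ∃[ c ] Decodes c vs (Adj G)
    codeOf {G} reg = code-surjective _≟_ n (allFin-unique n) (Adj G)
      (λ a b → adjᵇ G a b ≟ᵇ true) (Is2Regular⇒TwoRegular G reg)

    decoded-unique : ∀ {c} {G H : Graph n} → Decodes c vs (Adj G) → Decodes c vs (Adj H) → G ≡ H
    decoded-unique d d′ = graph-ext (D′.sound ∘ D.complete) (D.sound ∘ D′.complete)
      where
      module D = Decodes d
      module D′ = Decodes d′

    -- Graphs are exchanged for codes without loss in number: a code determines the graph it
    -- decodes, so distinct graphs receive distinct codes.
    collect-codes : ∀ {P : Code n → Set} {L : List (Graph n)} → Unique L →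
      All (λ G → ∃[ c ] (Decodes c vs (Adj G) × P c)) L →
      ∃[ cs ] (length cs ≡ length L × Unique cs × All P cs ×
               (∀ {c} → c ∈ cs → ∃[ G ] (G ∈ L × Decodes c vs (Adj G))))
    collect-codes [] [] = [] , refl , [] , [] , λ ()
    collect-codes (G∉ ∷ u) ((c , d , Pc) ∷ rest) with cs , len , uniq , all , origin ← collect-codes u rest =
      c ∷ cs , cong suc len , All.tabulate distinct ∷ uniq , Pc ∷ all ,
      λ { (here refl) → _ , here refl , d
        ; (there c∈) → let (G , G∈ , dG) = origin c∈ in G , there G∈ , dG }
      where
      distinct : ∀ {c′} → c′ ∈ cs → c ≢ c′
      distinct c∈ refl with _ , G∈ , dG ← origin c∈ = All.lookup G∉ G∈ (decoded-unique d dG)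

  -- Markov's inequality bounds the bad graphs by the number of codes, while the probability is
  -- taken over matrices; this is the comparison that links the two.
  regularCount≤num2Regular : ∀ n → regularCount n ≤ num2Regular n
  regularCount≤num2Regular n = begin
    regularCount n                       ≡⟨ length-codes n ⟨
    length (codes n)                     ≡⟨ length-map toGraph (codes n) ⟨
    length (map toGraph (codes n))       ≤⟨ length-≤ (Uniqueₚ.map⁺ toGraph-injective (codes-unique n)) regular ⟩
    num2Regular n                        ∎
    where
    open ≤-Reasoning
    regular : ∀ {G} → G ∈ map toGraph (codes n) → G ∈ filterᵇ is2Regularᵇ (allGraphs n)
    regular G∈ with c , _ , refl ← ∈-map⁻ toGraph G∈ =
      ∈-filter⁺ (T? ∘ is2Regularᵇ) (∈-allGraphs (toGraph c)) (toGraph-regular c)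

  -- Each listed code weighs at least D times the mean weight, and all codes together weigh
  -- `cycleWeight a b n`; its positivity permits the cancellation.
  markov : ∀ {n} a b D → 0 < cycleWeight a b n → (cs : List (Code n)) → Unique cs →
    All (λ c → D * cycleWeight a b n ≤ weight a b c * regularCount n) cs → length cs * D ≤ regularCount n
  markov {n} a b D pos cs uniq heavy = *-cancelʳ-≤ _ _ X {{>-nonZero pos}} (begin
    length cs * D * X                 ≡⟨ *-assoc (length cs) D X ⟩
    length cs * (D * X)               ≤⟨ total cs heavy ⟩
    sum (map (weight a b) cs) * A     ≤⟨ *-monoˡ-≤ A (sum-map-≤ (weight a b) uniq (λ {c} _ → ∈-codes c)) ⟩
    sum (map (weight a b) (codes n)) * A ≡⟨ cong (_* A) (sum-weights a b n) ⟩
    X * A                             ≡⟨ *-comm X A ⟩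
    A * X                             ∎)
    where
    open ≤-Reasoning
    X = cycleWeight a b n
    A = regularCount n
    total : ∀ cs → All (λ c → D * X ≤ weight a b c * A) cs → length cs * (D * X) ≤ sum (map (weight a b) cs) * A
    total []       []       = z≤n
    total (c ∷ cs) (h ∷ hs) = ≤-trans (+-mono-≤ h (total cs hs))
      (≤-reflexive (sym (*-distribʳ-+ A (weight a b c) (sum (map (weight a b) cs)))))

  split-All : ∀ {A : Set} {P Q : A → Set} (L : List A) → Unique L → All (λ x → P x ⊎ Q x) L →
    ∃[ L₁ ] ∃[ L₂ ] (length L ≡ length L₁ + length L₂ × Unique L₁ × Unique L₂ × All P L₁ × All Q L₂ ×
                     (∀ {x} → x ∈ L₁ → x ∈ L) × (∀ {x} → x ∈ L₂ → x ∈ L))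
  split-All [] [] [] = [] , [] , refl , [] , [] , [] , [] , (λ ()) , (λ ())
  split-All (x ∷ L) (x∉ ∷ u) (pq ∷ pqs)
    with L₁ , L₂ , len , u₁ , u₂ , ps , qs , ⊆₁ , ⊆₂ ← split-All L u pqs with pq
  ... | inj₁ p = x ∷ L₁ , L₂ , cong suc len , All.tabulate (All.lookup x∉ ∘ ⊆₁) ∷ u₁ , u₂ , p ∷ ps , qs ,
                 (λ { (here eq) → here eq ; (there y∈) → there (⊆₁ y∈) }) , there ∘ ⊆₂
  ... | inj₂ q = L₁ , x ∷ L₂ , trans (cong suc len) (sym (+-suc (length L₁) (length L₂))) ,
                 u₁ , All.tabulate (All.lookup x∉ ∘ ⊆₂) ∷ u₂ , ps , q ∷ qs ,
                 there ∘ ⊆₁ , (λ { (here eq) → here eq ; (there y∈) → there (⊆₂ y∈) })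

  cycleWeight-pos : ∀ a b .{{_ : NonZero a}} .{{_ : NonZero b}} n → 3 ≤ n → 0 < cycleWeight a b n
  cycleWeight-pos a b (suc (suc (suc m))) (s≤s (s≤s (s≤s _))) = cycleWeight>0 a b m

open RandomGraphs

-- Concentration of the hopping number: both tails combined.

open import Defs
open import Data.Nat using (ℕ; suc; _+_; _*_; _^_; _≤_)
open import Data.Nat.Properties using (≤-trans; *-monoʳ-≤; +-mono-≤; *-cancelˡ-≤; m≤m+n; m≤n+m; module ≤-Reasoning)
open import Data.Nat.Tactic.RingSolver using (solve-∀)
open import Data.Product using (∃-syntax; _×_; _,_; proj₁; proj₂)
open import Data.Sum using (_⊎_; inj₁; inj₂)
open import Data.List using (List; length)
open import Data.List.Relation.Unary.All as All using (All)
open import Data.List.Relation.Unary.Unique.Propositional using (Unique)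
open import Data.Vec using (allFin)
open import Relation.Binary.PropositionalEquality using (_≡_; cong; cong₂; sym; trans)

theorem1p1 : ∀ (t : ℕ) → ∃[ N ] (∀ n → N ≤ n → ∀ (L : List (Graph n)) →
    Unique L → All (Bad t n) L → length L * suc t ≤ num2Regular n)
theorem1p1 t = N , main
  where
  N₁ = proj₁ (lower-tail t)
  N₂ = proj₁ (upper-tail t)
  -- The summand 3 makes W(n) positive, as `markov` requires.
  N = N₁ + N₂ + 3
  -- Each tail is allowed half of the probability 1/(t+1).
  D = 2 * suc t

  Few Many : ∀ {n} → Code n → Set
  Few {n} c = D * cycleWeight (3 + 2 * t) (4 + 2 * t) n ≤ weight (3 + 2 * t) (4 + 2 * t) c * regularCount n
  Many {n} c = D * cycleWeight (4 + 2 * t) (3 + 2 * t) n ≤ weight (4 + 2 * t) (3 + 2 * t) c * regularCount n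

  classify : ∀ {n} → N ≤ n → {G : Graph n} → Bad t n G →
    ∃[ c ] (Decodes c (allFin n) (Adj G) × Few c) ⊎ ∃[ c ] (Decodes c (allFin n) (Adj G) × Many c)
  classify {n} N≤n {G} (reg , bad) with c , d ← codeOf {G = G} reg with bad
  -- One small feasible set is enough here, since its size is at least 3c.
  ... | inj₁ (B , feasible , le) = inj₁ (c , d ,
    proj₂ (lower-tail t) n (≤-trans (≤-trans (m≤m+n N₁ N₂) (m≤m+n _ 3)) N≤n) (cycles c) (weight _ _ c) (weight-cycles _ _ c)
      (ExpLe-antitone (n ^ (3 * t)) (*-monoʳ-≤ D (hopping-≥ G c d B feasible)) le))
  -- All feasible sets are large, in particular the one of size at most 3c made of seeds.
  ... | inj₂ gt with B , feasible , ∣B∣≤ ← hopping-≤ G c d = inj₂ (c , d ,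
    proj₂ (upper-tail t) n (≤-trans (≤-trans (m≤n+m N₂ N₁) (m≤m+n _ 3)) N≤n) (cycles c) (weight _ _ c) (weight-cycles _ _ c)
      (ExpGt-mono (n ^ (3 * (t + 2))) (*-monoʳ-≤ D ∣B∣≤) (gt B feasible)))

  main : ∀ n → N ≤ n → ∀ (L : List (Graph n)) → Unique L → All (Bad t n) L → length L * suc t ≤ num2Regular n
  main n N≤n L uniq bad
    with L₁ , L₂ , len , u₁ , u₂ , few , many , _ ← split-All L uniq (All.map (classify N≤n) bad)
    with cs₁ , len₁ , uniq₁ , few′ , _ ← collect-codes u₁ few
       | cs₂ , len₂ , uniq₂ , many′ , _ ← collect-codes u₂ many =
    ≤-trans (*-cancelˡ-≤ 2 (begin
      2 * (length L * suc t)                ≡⟨ cong (λ l → 2 * (l * suc t)) (trans len (sym (cong₂ _+_ len₁ len₂))) ⟩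
      2 * ((length cs₁ + length cs₂) * suc t) ≡⟨ e (length cs₁) (length cs₂) t ⟩
      length cs₁ * D + length cs₂ * D       ≤⟨ +-mono-≤ (markov _ _ D (cycleWeight-pos _ _ n 3≤n) cs₁ uniq₁ few′)
                                                         (markov _ _ D (cycleWeight-pos _ _ n 3≤n) cs₂ uniq₂ many′) ⟩
      regularCount n + regularCount n       ≡⟨ e′ (regularCount n) ⟩
      2 * regularCount n                    ∎)) (regularCount≤num2Regular n)
    where
    open ≤-Reasoning
    3≤n : 3 ≤ n
    3≤n = ≤-trans (m≤n+m 3 _) N≤n
    e : ∀ x y t → 2 * ((x + y) * suc t) ≡ x * (2 * suc t) + y * (2 * suc t)
    e = solve-∀
    e′ : ∀ x → x + x ≡ 2 * x
    e′ = solve-∀
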